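{- ${\rm CLU\#P}$ is closed under proper decrement: if $f\in{\rm CLU\#P}$ then the function $x\mapsto\max\{0,f(x)-1\}$ is in ${\rm CLU\#P}$.
   Context: Alphabet $\Sigma=\{0,1\}$; NPTM = nondeterministic polynomial-time Turing machine. For a polynomial $p$, an NPTM $M$ is $p$-balanced if on every input $x$ its computation paths correspond exactly to the guess strings in $\{0,1\}^{p(|x|)}$; paths are identified with guess strings. $\mathrm{acc}_M(x)$ is the set of accepting paths, $\#\mathrm{acc}_M(x)$ its size. ${\rm FP}_{\rm t}$: total polynomial-time computable functions. For same-length strings, $a\prec_{\rm lex}b$ means $b$ is the immediate lexicographic successor of $a$; $\le_{\rm lex}$ is lexicographic order. ${\rm CLU\#P}$: total $f:\Sigma^*\to\mathbb{N}$ such that there exist a polynomial $p$, a $p$-balanced NPTM $M$, $b,t\in{\rm FP}_{\rm t}$ and a polynomial-time 3-argument predicate $\prec$ such that for every $x$ there is a bijection $h_x$ of $\Sigma^{p(|x|)}$ with: $|b(x)|=|t(x)|=p(|x|)$; $h_x(b(x))=0^{p(|x|)}$, $h_x(t(x))=1^{p(|x|)}$; for $y,z\in\{0,1\}^{p(|x|)}$, $\prec(x,y,z)$ iff $h_x(y)\prec_{\rm lex}h_x(z)$; if $f(x)\neq0$ there exist $\ell,u$ with $\mathrm{acc}_M(x)=\{w\in\{0,1\}^{p(|x|)}: h_x(\ell)\le_{\rm lex}h_x(w)\le_{\rm lex}h_x(u)\}$; $f(x)=\#\mathrm{acc}_M(x)$. -}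

module Defs where

open import Data.Nat using (ℕ; zero; suc; _+_; _*_)
open import Data.Bool using (Bool; true; false)
open import Data.Fin using (Fin)
open import Data.List using (List; []; _∷_; length; map; filter; replicate; _++_)
open import Data.Maybe using (Maybe; just; nothing)
open import Data.Product using (Σ; ∃; ∃-syntax; _×_; _,_)
open import Relation.Binary.PropositionalEquality using (_≡_; _≢_)
open import Relation.Nullary using (¬_)
open import Data.Bool using (_≟_)
open import Function.Bundles using (_⇔_)

-- Strings over Σ = {0,1}: lists of Bool (false = 0, true = 1).

Str : Set
Str = List Bool

allStrings : ℕ → List Str
allStrings zero = [] ∷ []
allStrings (suc n) = map (false ∷_) (allStrings n) ++ map (true ∷_) (allStrings n)

Poly : Set
Poly = List ℕ

eval : Poly → ℕ → ℕ
eval [] n = 0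
eval (c ∷ cs) n = c + n * eval cs n

data Sym : Set where
  s0 s1 sep blank : Sym

data Move : Set where
  L R S : Move

record TM : Set where
  field
    Q         : ℕ
    start     : Fin Q
    δ         : Fin Q → Sym → Maybe (Fin Q × Sym × Move)   -- nothing = halt
    accepting : Fin Q → Bool

-- configuration: state, tape left of the head (reversed), tape from the head on
record Config (M : TM) : Set where
  constructor conf
  field
    state : Fin (TM.Q M)
    left  : List Sym
    right : List Sym

readHead : List Sym → Sym
readHead [] = blank
readHead (c ∷ _) = c

writeHead : Sym → List Sym → List Sym
writeHead s [] = s ∷ []
writeHead s (_ ∷ r) = s ∷ r

doMove : Move → List Sym → List Sym → List Sym × List Sym
doMove L [] r = [] , r                 -- left end of the tape: stay
doMove L (l ∷ ls) r = ls , l ∷ r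
doMove R ls [] = blank ∷ ls , []
doMove R ls (c ∷ r) = c ∷ ls , r
doMove S ls r = ls , r

step : (M : TM) → Config M → Maybe (Config M)
step M (conf q l r) with TM.δ M q (readHead r)
... | nothing = nothing
... | just (q' , s , m) with doMove m l (writeHead s r)
...   | (l' , r') = just (conf q' l' r')

run : (M : TM) → ℕ → Config M → Config M
run M zero c = c
run M (suc t) c with step M c
... | nothing = c
... | just c' = run M t c'

initConf : (M : TM) → List Sym → Config M
initConf M w = conf (TM.start M) [] w

Halted : (M : TM) → Config M → Set
Halted M c = step M c ≡ nothing

HaltsWithin : TM → ℕ → List Sym → Set
HaltsWithin M t w = Halted M (run M t (initConf M w))

-- acceptance verdict after t steps (meaningful once the machine has halted)
acceptsIn : TM → ℕ → List Sym → Bool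
acceptsIn M t w = TM.accepting M (Config.state (run M t (initConf M w)))

readBits : List Sym → Str
readBits (s0 ∷ r) = false ∷ readBits r
readBits (s1 ∷ r) = true ∷ readBits r
readBits _ = []

outputIn : TM → ℕ → List Sym → Str
outputIn M t w = readBits (Config.right (run M t (initConf M w)))

enc : Str → List Sym
enc [] = []
enc (false ∷ x) = s0 ∷ enc x
enc (true ∷ x) = s1 ∷ enc x

enc2 : Str → Str → List Sym
enc2 x y = enc x ++ (sep ∷ enc y)

enc3 : Str → Str → Str → List Sym
enc3 x y z = enc x ++ (sep ∷ enc y ++ (sep ∷ enc z))

FPt : (Str → Str) → Set
FPt f = Σ TM λ M → Σ Poly λ q → ∀ x →
  HaltsWithin M (eval q (length x)) (enc x) × outputIn M (eval q (length x)) (enc x) ≡ f x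

record PolyPred3 : Set where
  field
    machine : TM
    bound   : Poly
    total   : ∀ x y z → HaltsWithin machine (eval bound (length x + length y + length z)) (enc3 x y z)

holds3 : PolyPred3 → Str → Str → Str → Set
holds3 P x y z = acceptsIn (PolyPred3.machine P)
  (eval (PolyPred3.bound P) (length x + length y + length z)) (enc3 x y z) ≡ true

-- p-balanced NPTM: on input x the paths are the guess strings w ∈ {0,1}^{p(|x|)};
-- path w is the deterministic polynomial-time run of `machine` on (x, w).
record BalancedNPTM (p : Poly) : Set where
  field
    machine : TM
    bound   : Poly
    total   : ∀ x w → length w ≡ eval p (length x) →
              HaltsWithin machine (eval bound (length x)) (enc2 x w)

accPath : ∀ {p} → BalancedNPTM p → Str → Str → Bool
accPath M x w = acceptsIn (BalancedNPTM.machine M) (eval (BalancedNPTM.bound M) (length x)) (enc2 x w)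

-- acc_M(x) membership (for w of length p(|x|))
Acc : ∀ {p} → BalancedNPTM p → Str → Str → Set
Acc M x w = accPath M x w ≡ true

numAcc : ∀ {p} → BalancedNPTM p → Str → ℕ
numAcc {p} M x = length (filter (λ w → accPath M x w ≟ true) (allStrings (eval p (length x))))

-- Lexicographic order on strings (0 < 1), used on strings of equal length.

data _≤lex_ : Str → Str → Set where
  []≤    : ∀ {b} → [] ≤lex b
  0<1    : ∀ {a b} → (false ∷ a) ≤lex (true ∷ b)
  same   : ∀ {c a b} → a ≤lex b → (c ∷ a) ≤lex (c ∷ b)

_<lex_ : Str → Str → Set
a <lex b = a ≤lex b × a ≢ b

_≺lex_ : Str → Str → Set
a ≺lex b = length a ≡ length b × a <lex b ×
           (∀ c → length c ≡ length a → a <lex c → b ≤lex c)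

IsBijOn : ℕ → (Str → Str) → Set
IsBijOn n h =
  (∀ w → length w ≡ n → length (h w) ≡ n) ×
  (∀ v w → length v ≡ n → length w ≡ n → h v ≡ h w → v ≡ w) ×
  (∀ u → length u ≡ n → ∃[ w ] (length w ≡ n × h w ≡ u))

CLUSharpP : (Str → ℕ) → Set
CLUSharpP f =
  Σ Poly λ p → Σ (BalancedNPTM p) λ M →
  Σ (Str → Str) λ b → Σ (Str → Str) λ t → FPt b × FPt t ×
  Σ PolyPred3 λ prec →
  ∀ x → let n = eval p (length x) in
  Σ (Str → Str) λ h →
    IsBijOn n h ×
    length (b x) ≡ n × length (t x) ≡ n ×
    h (b x) ≡ replicate n false × h (t x) ≡ replicate n true ×
    (∀ y z → length y ≡ n → length z ≡ n → (holds3 prec x y z ⇔ (h y ≺lex h z))) ×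
    (f x ≢ 0 → ∃[ l ] ∃[ u ] (length l ≡ n × length u ≡ n ×
        (∀ w → length w ≡ n → (Acc M x w ⇔ (h l ≤lex h w × h w ≤lex h u))))) ×
    f x ≡ numAcc M x

{-# OPTIONS --safe #-}
module Submission where

-- A path of the new machine is a pair (y , z) of old paths, interleaved bit by bit; it accepts iff y and z
-- both accept and y ≺ z. The accepting paths of the old machine form a chain l ≺ ... ≺ u, so the new machine
-- has exactly one accepting path fewer (none, if there was none).
--
-- To make the new accepting paths an interval, let a and c be the ranks of y and z and N = 2^n the number of
-- old paths, and order the pairs by ((c - a - 1) mod N , c). The first block, c = a + 1 mod N, starts with
-- (t , b) and then consists of the pairs with y ≺ z, in order; the last pair is (t , t). So the bottom and
-- top are computable from b and t alone. Adjacency is decidable from ≺ as well: inside a block both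
-- components advance cyclically, and after the last pair (y , t) of a block, with y ≠ t, comes (y , b).
--
-- For the machines, programs over finitely many bit stacks, which can simulate given Turing machines, are
-- compiled to single-tape machines with polynomial overhead.

open import Defs
open import Data.Nat using (ℕ; zero; suc; _+_; _*_; _∸_; _^_; _/_; _%_; _≤_; _<_; z≤n; s≤s; NonZero; _<?_)
open import Data.Nat.Properties
open import Data.Nat.DivMod using (m≡m%n+[m/n]*n; m%n<n; m<n*o⇒m/o<n)
open import Data.Nat.Tactic.RingSolver using (solve-∀)
open import Data.Bool using (Bool; true; false; _∧_; _∨_; not)
import Data.Bool as Bool
open import Data.Empty using (⊥; ⊥-elim)
open import Data.Fin using (Fin; zero; suc; toℕ; inject₁; fromℕ; #_)
open import Data.Fin.Properties using (toℕ-inject₁; toℕ-fromℕ)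
open import Data.List using (List; []; _∷_; _++_; _ʳ++_; [_]; length; map; concatMap; filter; allFin; head; drop; reverse; replicate)
import Data.List as List
open import Data.List.Properties
open import Data.List.Membership.Propositional using (_∈_; lose)
open import Data.List.Membership.Propositional.Properties
open import Data.List.Relation.Unary.All as All using (All; []; _∷_)
import Data.List.Relation.Unary.All.Properties as All
open import Data.List.Relation.Unary.AllPairs using ([]; _∷_)
open import Data.List.Relation.Unary.Any as Any using (here; there)
open import Data.List.Relation.Unary.Any.Properties using (lookup-index)
open import Data.List.Relation.Unary.Unique.Propositional using (Unique)
import Data.List.Relation.Unary.Unique.Propositional.Properties as Unique
open import Data.Maybe using (Maybe; just; nothing; fromMaybe)
import Data.Maybe as Maybe
open import Data.Product using (Σ; ∃-syntax; _×_; _,_; proj₁; proj₂)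
open import Data.Sum using (_⊎_; inj₁; inj₂; [_,_]′)
open import Data.Unit using (⊤; tt)
open import Data.Vec using (Vec; []; _∷_; lookup; _[_]≔_)
open import Data.Vec.Properties using ([]≔-lookup; []≔-idempotent; []≔-commutes; lookup∘update)
open import Function using (_∘_)
open import Function.Bundles using (_⇔_; mk⇔; Equivalence)
open import Relation.Binary.PropositionalEquality hiding ([_])
open import Relation.Nullary using (¬_; yes; no; contradiction)

-- Simply dropping an end of the accepting interval does not work: whether a path is the last
-- accepted one depends on its successor, and `≺` only tests two given paths for adjacency, it does
-- not produce a neighbour. So the neighbour is guessed as well. This squares the number of paths,
-- and all pairs, the rejecting ones included, need a linear order whose adjacency is decided
-- without knowing any rank: only `≺`, equality, `b` and `t` can be consulted. A row-by-row order
-- would scatter the pairs with `y ≺ z` over the rows. Diagonals, where c - a is constant modulo N,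
-- keep them together, and a step along a diagonal is one step in each component. Sorting a diagonal
-- by c makes the passage to the next one simple: c goes from N - 1 to 0, which is again a cyclic
-- step, and c - a - 1 grows by one exactly when a stays fixed. For `f x` equal to 0 no interval is
-- given, so that case rests on counting alone.

-- Finite types

record Listable (A : Set) : Set where
  constructor listing
  field
    elements : List A
    complete : ∀ a → a ∈ elements

open Listable {{...}}

instance
  listable-⊤ : Listable ⊤
  listable-⊤ = listing (tt ∷ []) λ _ → here refl

  listable-Bool : Listable Bool
  listable-Bool = listing (false ∷ true ∷ []) λ { false → here refl ; true → there (here refl) }

  listable-Sym : Listable Sym
  listable-Sym = listing (s0 ∷ s1 ∷ sep ∷ blank ∷ []) λ where
    s0    → here refl
    s1    → there (here refl)
    sep   → there (there (here refl))
    blank → there (there (there (here refl)))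

  listable-Fin : ∀ {n} → Listable (Fin n)
  listable-Fin {n} = listing (allFin n) ∈-allFin

  listable-Maybe : {A : Set} {{_ : Listable A}} → Listable (Maybe A)
  listable-Maybe = listing (nothing ∷ map just elements) λ where
    nothing  → here refl
    (just a) → there (∈-map⁺ just (complete a))

  listable-⊎ : {A B : Set} {{_ : Listable A}} {{_ : Listable B}} → Listable (A ⊎ B)
  listable-⊎ = listing (map inj₁ elements ++ map inj₂ elements) λ where
    (inj₁ a) → ∈-++⁺ˡ (∈-map⁺ inj₁ (complete a))
    (inj₂ b) → ∈-++⁺ʳ _ (∈-map⁺ inj₂ (complete b))

listable-Σ : {A : Set} {B : A → Set} → Listable A → (∀ a → Listable (B a)) → Listable (Σ A B)
listable-Σ LA LB = listing
  (concatMap (λ a → map (a ,_) (elements {{LB a}})) (elements {{LA}}))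
  λ (a , b) → ∈-concatMap⁺ (λ a → map (a ,_) (elements {{LB a}}))
                (lose (complete {{LA}} a) (∈-map⁺ (a ,_) (complete {{LB a}} b)))

-- Turing machines over an arbitrary finite state type

Tape : Set
Tape = List Sym × List Sym

Table : Set → Set
Table Q = Q → Sym → Maybe (Q × Sym × Move)

module _ {Q : Set} (δ : Table Q) where

  -- The time index is only an upper bound.
  data Reach : Q × Tape → ℕ → Q × Tape → Set where
    stop : ∀ {c n} → Reach c n c
    go   : ∀ {q l r q' s m n c} → δ q (readHead r) ≡ just (q' , s , m) →
           Reach (q' , doMove m l (writeHead s r)) n c → Reach (q , l , r) (suc n) c

module _ {Q : Set} {δ : Table Q} where

  reach-weaken : ∀ {c c' m n} → m ≤ n → Reach δ c m c' → Reach δ c n c'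
  reach-weaken m≤n stop = stop
  reach-weaken (s≤s m≤n) (go eq r) = go eq (reach-weaken m≤n r)

  infixr 5 _◅◅_
  _◅◅_ : ∀ {c c' c'' m n} → Reach δ c m c' → Reach δ c' n c'' → Reach δ c (m + n) c''
  _◅◅_ {m = m} {n} stop r = reach-weaken (m≤n+m n m) r
  go eq r ◅◅ r' = go eq (r ◅◅ r')

module _ {Q : Set} {{_ : Listable Q}} (q₀ : Q) (δ : Table Q) (acc : Q → Bool) where

  private
    encode : Q → Fin (length (elements {Q}))
    encode q = Any.index (complete q)

    decode : Fin (length (elements {Q})) → Q
    decode = List.lookup elements

    decode-encode : ∀ q → decode (encode q) ≡ q
    decode-encode q = sym (lookup-index (complete q))

  toTM : TM
  toTM = record
    { Q         = length (elements {Q})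
    ; start     = encode q₀
    ; δ         = λ f s → Maybe.map (λ (q , m) → encode q , m) (δ (decode f) s)
    ; accepting = λ f → acc (decode f)
    }

  private
    embed : Q × Tape → Config toTM
    embed (q , l , r) = conf (encode q) l r

  step-just : ∀ {q l r q' s m} → δ q (readHead r) ≡ just (q' , s , m) →
              step toTM (embed (q , l , r)) ≡ just (embed (q' , doMove m l (writeHead s r)))
  step-just {q} eq rewrite decode-encode q | eq = refl

  step-nothing : ∀ {q l r} → δ q (readHead r) ≡ nothing → step toTM (embed (q , l , r)) ≡ nothing
  step-nothing {q} eq rewrite decode-encode q | eq = refl

  run-halted : ∀ T {c} → step toTM c ≡ nothing → run toTM T c ≡ c
  run-halted zero h = refl
  run-halted (suc T) h rewrite h = refl

  run-just : ∀ T {c c'} → step toTM c ≡ just c' → run toTM (suc T) c ≡ run toTM T c'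
  run-just T h rewrite h = refl

  run-reach : ∀ {c q l r n T} → Reach δ c n (q , l , r) → δ q (readHead r) ≡ nothing → n ≤ T →
              run toTM T (embed c) ≡ embed (q , l , r)
  run-reach {T = T} stop h _ = run-halted T (step-nothing h)
  run-reach (go {l = l} eq p) h (s≤s {n = T} n≤T) = trans (run-just T (step-just {l = l} eq)) (run-reach p h n≤T)

  toTM-reach : ∀ {w q l r n T} → Reach δ (q₀ , [] , w) n (q , l , r) → δ q (readHead r) ≡ nothing → n ≤ T →
    HaltsWithin toTM T w × acceptsIn toTM T w ≡ acc q × outputIn toTM T w ≡ readBits r
  toTM-reach {q = q} {l} p h n≤T rewrite run-reach p h n≤T =
    step-nothing {l = l} h , cong acc (decode-encode q) , refl

-- Machines with K stacks of bits

Store : ℕ → Set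
Store K = Vec Str K

-- `T` is the type of continuations. Leaving it open lets `mapI` relabel the instructions of a
-- program when it becomes part of a larger one or of a Turing machine.
data Instr (K : ℕ) (T : Set) : Set where
  nop : T → Instr K T
  psh : Fin K → Bool → T → Instr K T
  pp  : Fin K → (Maybe Bool → T) → Instr K T

mapI : ∀ {K} {T T' : Set} → (T → T') → Instr K T → Instr K T'
mapI f (nop t)     = nop (f t)
mapI f (psh i b t) = psh i b (f t)
mapI f (pp i k)    = pp i (λ m → f (k m))

apply : ∀ {K} {T : Set} → Instr K T → Store K → T × Store K
apply (nop t) σ     = t , σ
apply (psh i b t) σ = t , σ [ i ]≔ (b ∷ lookup σ i)
apply (pp i k) σ    = k (head (lookup σ i)) , σ [ i ]≔ drop 1 (lookup σ i)

-- Tape layout: left of the head, nearest first, lie the stacks, each preceded by a separator;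
-- the head rests on the blank part of the tape.

bit : Bool → Sym
bit false = s0
bit true  = s1

enc-∷ : ∀ b x → enc (b ∷ x) ≡ bit b ∷ enc x
enc-∷ false x = refl
enc-∷ true x  = refl

lay : ∀ {K} → Store K → List Sym
lay []      = []
lay (s ∷ σ) = sep ∷ enc s ++ lay σ

under : ∀ {K} → Store K → Fin K → List Sym
under (s ∷ σ) zero    = lay σ
under (s ∷ σ) (suc i) = under σ i

-- The cells between the separator of stack `i` and the blank part, both excluded. They are listed
-- from left to right, as they lie right of the head once it stands on that separator, whereas `lay`
-- and `under` list cells from right to left.
over : ∀ {K} → Store K → Fin K → List Sym
over (s ∷ σ) zero    = []
over (s ∷ σ) (suc i) = over σ i ++ (enc s ʳ++ [ sep ])

over-lay-under : ∀ {K} (σ : Store K) i v → over σ i ʳ++ (sep ∷ enc v ++ under σ i) ≡ lay (σ [ i ]≔ v)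
over-lay-under (s ∷ σ) zero v = refl
over-lay-under (s ∷ σ) (suc i) v
  rewrite ++-ʳ++ (over σ i) {enc s ʳ++ [ sep ]} {sep ∷ enc v ++ under σ i}
        | over-lay-under σ i v = ʳ++-ʳ++ (enc s)

-- Writing on an empty right part creates an explicit cell, so the number of listed blanks depends
-- on the history of the run. Runs are therefore stated up to that number.
Blanks : List Sym → Set
Blanks = All (_≡ blank)

Marks : List Sym → Set
Marks = All (_≢ blank)

length-enc : ∀ s → length (enc s) ≡ length s
length-enc []          = refl
length-enc (false ∷ s) = cong suc (length-enc s)
length-enc (true ∷ s)  = cong suc (length-enc s)

enc-marks : ∀ x → Marks (enc x)
enc-marks [] = []
enc-marks (false ∷ x) = (λ ()) ∷ enc-marks x
enc-marks (true ∷ x)  = (λ ()) ∷ enc-marks x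

ʳ++-marks : ∀ xs {ys} → Marks xs → Marks ys → Marks (xs ʳ++ ys)
ʳ++-marks [] _ q = q
ʳ++-marks (x ∷ xs) (p ∷ ps) q = ʳ++-marks xs ps (p ∷ q)

over-marks : ∀ {K} (σ : Store K) i → Marks (over σ i)
over-marks (s ∷ σ) zero = []
over-marks (s ∷ σ) (suc i) = All.++⁺ (over-marks σ i) (ʳ++-marks (enc s) (enc-marks s) ((λ ()) ∷ []))

size : ∀ {K} → Store K → ℕ
size σ = length (lay σ)

-- A pop erases the bit by copying everything to its right one cell to the left: grab reads the next
-- symbol, put writes it over the current one, skip moves on, and erase clears the last cell.
data Phase (K : ℕ) : Set where
  home look back   : Phase K
  seek             : Fin K → Phase K
  carry            : Sym → Phase K
  grab skip erase  : Bool → Phase K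
  put              : Bool → Sym → Phase K

private
  there⁹ : ∀ {A : Set} {a b c d e f g h i x : A} {xs} → x ∈ xs →
           x ∈ a ∷ b ∷ c ∷ d ∷ e ∷ f ∷ g ∷ h ∷ i ∷ xs
  there⁹ p = there (there (there (there (there (there (there (there (there p))))))))

instance
  listable-Phase : ∀ {K} → Listable (Phase K)
  listable-Phase {K} = listing
    (home ∷ look ∷ back ∷ grab false ∷ grab true ∷ skip false ∷ skip true ∷ erase false ∷ erase true ∷
     map seek (allFin K) ++ map carry elements ++ map (put false) elements ++ map (put true) elements)
    λ where
      home          → here refl
      look          → there (here refl)
      back          → there (there (here refl))
      (grab false)  → there (there (there (here refl)))
      (grab true)   → there (there (there (there (here refl))))
      (skip false)  → there (there (there (there (there (here refl)))))
      (skip true)   → there (there (there (there (there (there (here refl))))))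
      (erase false) → there (there (there (there (there (there (there (here refl)))))))
      (erase true)  → there (there (there (there (there (there (there (there (here refl))))))))
      (seek i)      → there⁹ (∈-++⁺ˡ (∈-map⁺ seek (∈-allFin i)))
      (carry s)     → there⁹ (∈-++⁺ʳ seeks (∈-++⁺ˡ (∈-map⁺ carry (complete s))))
      (put false s) → there⁹ (∈-++⁺ʳ seeks (∈-++⁺ʳ carries (∈-++⁺ˡ (∈-map⁺ (put false) (complete s)))))
      (put true s)  → there⁹ (∈-++⁺ʳ seeks (∈-++⁺ʳ carries (∈-++⁺ʳ (map (put false) elements)
                        (∈-map⁺ (put true) (complete s)))))
    where
    seeks carries : List (Phase K)
    seeks   = map seek (allFin K)
    carries = map carry elements

module _ {K : ℕ} {Q : Set} (at : Phase K → Q) where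

  -- In phase `seek j` the head has `j` separators to cross before it meets the one of the wanted
  -- stack.
  seeking : Q × Sym × Move → Sym → Fin K → Q × Sym × Move
  seeking hit sep zero    = hit
  seeking hit sep (suc j) = at (seek (inject₁ j)) , sep , L
  seeking hit c j         = at (seek j) , c , L

  -- A push overwrites the separator of its stack with the new bit and moves that separator, and all
  -- that follows, one cell to the right. The symbol in transit is kept in the state.
  carrying : Q → Sym → Sym → Q × Sym × Move
  carrying t d blank = t , d , R
  carrying t d c     = at (carry c) , d , R

  looking : Sym → Q × Sym × Move
  looking s0    = at (grab false) , s0 , R
  looking s1    = at (grab true) , s1 , R
  looking sep   = at back , sep , S
  looking blank = at back , blank , S

  returning : Q → Sym → Q × Sym × Move
  returning t blank = t , blank , S
  returning t c     = at back , c , R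

  grabbing : Bool → Sym → Q × Sym × Move
  grabbing b blank = at (erase b) , blank , L
  grabbing b c     = at (put b c) , c , L

  pushing : Bool → Q → Phase K → Sym → Q × Sym × Move
  pushing b t (seek j)  c = seeking (at (carry sep) , bit b , R) c j
  pushing b t (carry d) c = carrying t d c
  pushing b t _         c = t , c , S

  popping : (Maybe Bool → Q) → Phase K → Sym → Q × Sym × Move
  popping k (seek j)  c = seeking (at look , sep , L) c j
  popping k look      c = looking c
  popping k back      c = returning (k nothing) c
  popping k (grab b)  c = grabbing b c
  popping k (put b d) c = at (skip b) , d , R
  popping k (skip b)  c = at (grab b) , c , R
  popping k (erase b) c = k (just b) , blank , S
  popping k _         c = k nothing , c , S

  move : Instr K Q → Phase K → Sym → Q × Sym × Move
  move (nop t) _ c        = t , c , S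
  move (psh i b t) home c = at (seek i) , c , L
  move (psh i b t) ph c   = pushing b t ph c
  move (pp i k) home c    = at (seek i) , c , L
  move (pp i k) ph c      = popping k ph c

module _ {K : ℕ} {Q : Set} {at : Phase K → Q} {δ : Table Q} where

  private
    infix 4 _⟶⟨_⟩_
    _⟶⟨_⟩_ : Q × Tape → ℕ → Q × Tape → Set
    _⟶⟨_⟩_ = Reach δ

  walk-run : ∀ {hit} → (∀ j c → δ (at (seek j)) c ≡ just (seeking at hit c j)) → ∀ j s {l r} →
    (at (seek j) , doMove L (enc s ++ sep ∷ l) r) ⟶⟨ length s ⟩ (at (seek j) , l , sep ∷ (enc s ʳ++ r))
  walk-run H j []          = stop
  walk-run H j (false ∷ s) = go (H j s0) (walk-run H j s)
  walk-run H j (true ∷ s)  = go (H j s1) (walk-run H j s)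

  -- The counter `j` stays in `Fin K`, while `i` indexes the part of the store still ahead, which
  -- shrinks; hence they are tied through `toℕ` only. The continuation is an argument because push
  -- and pop act differently on the separator that is found.
  seek-run : ∀ {q s m} → (∀ j c → δ (at (seek j)) c ≡ just (seeking at (q , s , m) c j)) →
    ∀ {k} (σ : Store (suc k)) j i → toℕ j ≡ toℕ i → ∀ {w n c} →
    (q , doMove m (enc (lookup σ i) ++ under σ i) (s ∷ over σ i ++ w)) ⟶⟨ n ⟩ c →
    (at (seek j) , drop 1 (lay σ) , sep ∷ w) ⟶⟨ length (over σ i) + suc n ⟩ c
  seek-run H (s ∷ σ) zero zero _ p = go (H zero sep) p
  seek-run H (s ∷ s' ∷ σ) (suc j) (suc i) j≡i {w} {n} p =
    reach-weaken (≤-reflexive time) (go (H (suc j) sep) (walk-run H (inject₁ j) s ◅◅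
      seek-run H (s' ∷ σ) (inject₁ j) i (trans (toℕ-inject₁ j) (suc-injective j≡i))
        (subst (λ v → (_ , doMove _ _ (_ ∷ v)) ⟶⟨ _ ⟩ _) shuffle p)))
    where
    o = over (s' ∷ σ) i
    shuffle : (o ++ (enc s ʳ++ [ sep ])) ++ w ≡ o ++ (enc s ʳ++ sep ∷ w)
    shuffle = trans (++-assoc o _ w) (cong (o ++_) (sym (trans (ʳ++-defn (enc s))
      (trans (sym (++-assoc (reverse (enc s)) [ sep ] w)) (cong (_++ w) (sym (ʳ++-defn (enc s))))))))
    time : suc (length s + (length o + suc n)) ≡ length (o ++ (enc s ʳ++ [ sep ])) + suc n
    time rewrite length-++ o {enc s ʳ++ [ sep ]} | length-ʳ++ (enc s) {[ sep ]} | length-enc s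
               | +-comm (length s) 1 | +-suc (length o) (length s) = 
      cong suc (trans (sym (+-assoc (length s) (length o) (suc n))) (cong (_+ suc n) (+-comm (length s) (length o))))

  carry-run : ∀ {t} → (∀ d c → δ (at (carry d)) c ≡ just (carrying at t d c)) →
    ∀ d w {l r} → Marks w → Blanks r →
    ∃[ r' ] Blanks r' × (at (carry d) , l , w ++ r) ⟶⟨ suc (length w) ⟩ (t , (w ʳ++ (d ∷ l)) , r')
  carry-run H d [] [] [] = _ , [] , go (H d blank) stop
  carry-run H d [] [] (refl ∷ br) = _ , br , go (H d blank) stop
  carry-run H d (s0 ∷ w) (_ ∷ mw) br with r' , br' , p ← carry-run H s0 w mw br = r' , br' , go (H d s0) p
  carry-run H d (s1 ∷ w) (_ ∷ mw) br with r' , br' , p ← carry-run H s1 w mw br = r' , br' , go (H d s1) p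
  carry-run H d (sep ∷ w) (_ ∷ mw) br with r' , br' , p ← carry-run H sep w mw br = r' , br' , go (H d sep) p
  carry-run H d (blank ∷ w) (m ∷ _) br = contradiction refl m

  return-run : ∀ {t} → (∀ c → δ (at back) c ≡ just (returning at t c)) →
    ∀ w {l r} → Marks w → Blanks r →
    ∃[ r' ] Blanks r' × (at back , l , w ++ r) ⟶⟨ suc (length w) ⟩ (t , (w ʳ++ l) , r')
  return-run H [] [] [] = _ , refl ∷ [] , go (H blank) stop
  return-run H [] [] (refl ∷ br) = _ , refl ∷ br , go (H blank) stop
  return-run H (s0 ∷ w) (_ ∷ mw) br with r' , br' , p ← return-run H w mw br = r' , br' , go (H s0) p
  return-run H (s1 ∷ w) (_ ∷ mw) br with r' , br' , p ← return-run H w mw br = r' , br' , go (H s1) p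
  return-run H (sep ∷ w) (_ ∷ mw) br with r' , br' , p ← return-run H w mw br = r' , br' , go (H sep) p
  return-run H (blank ∷ w) (m ∷ _) br = contradiction refl m

  -- The symbol `x` left of the head is obsolete: it is the popped bit itself, or it has already
  -- been copied one cell to the left. The factor 3 stands for `grab`, `put` and `skip`.
  delete-run : ∀ {i k} b → (∀ ph c → δ (at ph) c ≡ just (move at (pp i k) ph c)) →
    ∀ x w {l r} → Marks w → Blanks r →
    ∃[ r' ] Blanks r' ×
      (at (grab b) , (x ∷ l) , w ++ r) ⟶⟨ 3 * length w + 2 ⟩ (k (just b) , (w ʳ++ l) , r')
  delete-run b H x [] [] [] = _ , refl ∷ refl ∷ [] , go (H (grab b) blank) (go (H (erase b) _) stop)
  delete-run b H x [] [] (refl ∷ br) =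
    _ , refl ∷ refl ∷ br , go (H (grab b) blank) (go (H (erase b) _) stop)
  delete-run {k = k} b H x (c ∷ w) {l} {r} (m ∷ mw) br with r' , br' , p ← delete-run b H c w {c ∷ l} mw br =
    r' , br' , reach-weaken (≤-reflexive (cong (_+ 2) (sym (*-suc 3 (length w)))))
      (go (grab-step c m) (go (H (put b c) x) (go (H (skip b) c) p)))
    where
    grab-step : ∀ c → c ≢ blank → δ (at (grab b)) c ≡ just (at (put b c) , c , L)
    grab-step s0 _    = H (grab b) s0
    grab-step s1 _    = H (grab b) s1
    grab-step sep _   = H (grab b) sep
    grab-step blank m = contradiction refl m

  over-length : ∀ {K'} (σ : Store K') i → suc (length (over σ i)) ≤ size σ
  over-length σ i = begin
    suc (length (over σ i))                                     ≤⟨ s≤s (m≤m+n _ _) ⟩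
    suc (length (over σ i) + length below)                      ≡⟨ +-suc (length (over σ i)) (length below) ⟨
    length (over σ i) + suc (length below)                      ≡⟨ length-ʳ++ (over σ i) ⟨
    length (over σ i ʳ++ (sep ∷ below))                         ≡⟨ cong length (over-lay-under σ i (lookup σ i)) ⟩
    size (σ [ i ]≔ lookup σ i)                                  ≡⟨ cong size ([]≔-lookup σ i) ⟩
    size σ                                                      ∎
    where
    open ≤-Reasoning
    below : List Sym
    below = enc (lookup σ i) ++ under σ i

  -- A move left at cell 0 leaves the head on the separator, which pop then reads as an empty stack.
  under-shape : ∀ {k} (σ : Store k) i → (under σ i ≡ []) ⊎ (∃[ u ] under σ i ≡ sep ∷ u)
  under-shape (s ∷ []) zero     = inj₁ refl
  under-shape (s ∷ s' ∷ σ) zero = inj₂ (_ , refl)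
  under-shape (s ∷ σ) (suc i)   = under-shape σ i

  private
    refresh : ∀ {r} → Blanks r → Blanks (writeHead (readHead r) r)
    refresh []          = refl ∷ []
    refresh (refl ∷ br) = refl ∷ br

    push-time : ∀ o n → suc o ≤ n → suc (o + suc (suc o)) ≤ 4 * n + 5
    push-time o n o<n = begin
      suc (o + suc (suc o)) ≡⟨ cong suc (+-suc o (suc o)) ⟩
      2 + (o + suc o)       ≤⟨ +-monoʳ-≤ 2 (+-mono-≤ (<⇒≤ o<n) o<n) ⟩
      2 + (n + n)           ≤⟨ +-mono-≤ {2} {5} (s≤s (s≤s z≤n)) (+-monoʳ-≤ n (m≤m+n n _)) ⟩
      5 + 4 * n             ≡⟨ +-comm 5 (4 * n) ⟩
      4 * n + 5             ∎
      where open ≤-Reasoning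

    pop-time : ∀ o n t → suc o ≤ n → t ≤ 3 * suc o + 3 → suc (o + suc t) ≤ 4 * n + 5
    pop-time o n t o<n t≤ = begin
      suc (o + suc t)               ≡⟨ cong suc (+-suc o t) ⟩
      1 + (suc o + t)               ≤⟨ +-monoʳ-≤ 1 (+-mono-≤ o<n t≤) ⟩
      1 + (n + (3 * suc o + 3))     ≤⟨ +-monoʳ-≤ 1 (+-monoʳ-≤ n (+-monoˡ-≤ 3 (*-monoʳ-≤ 3 o<n))) ⟩
      1 + (n + (3 * n + 3))         ≡⟨ cong suc (sym (+-assoc n (3 * n) 3)) ⟩
      1 + (4 * n + 3)               ≡⟨ sym (+-suc (4 * n) 3) ⟩
      4 * n + 4                     ≤⟨ +-monoʳ-≤ (4 * n) (n≤1+n 4) ⟩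
      4 * n + 5                     ∎
      where open ≤-Reasoning

  -- The factor 4 comes from a pop: one move per cell to reach the stack and three per cell to close
  -- the gap on the way back.
  instr-run : ∀ I → (∀ ph c → δ (at ph) c ≡ just (move at I ph c)) → ∀ (σ : Store K) {r} → Blanks r →
    ∃[ r' ] Blanks r' × (at home , lay σ , r) ⟶⟨ 4 * size σ + 5 ⟩
      (proj₁ (apply I σ) , lay (proj₂ (apply I σ)) , r')
  instr-run (nop t) H σ br =
    _ , refresh br , reach-weaken (≤-trans (s≤s z≤n) (m≤n+m 5 (4 * size σ))) (go (H home _) stop)
  instr-run (psh i b t) H (s ∷ σ') br
    with r' , br' , p ← carry-run {t} (λ d → H (carry d)) sep (over (s ∷ σ') i) (over-marks (s ∷ σ') i) (refresh br) =
    r' , br' , subst (λ v → _ ⟶⟨ _ ⟩ (t , v , r')) eq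
      (reach-weaken (push-time (length (over σ i)) (size σ) (over-length σ i))
        (go (H home _) (seek-run (λ j → H (seek j)) σ i i refl p)))
    where
    σ = s ∷ σ'
    eq : over σ i ʳ++ (sep ∷ bit b ∷ enc (lookup σ i) ++ under σ i) ≡ lay (σ [ i ]≔ (b ∷ lookup σ i))
    eq rewrite sym (over-lay-under σ i (b ∷ lookup σ i)) | enc-∷ b (lookup σ i) = refl
  instr-run (pp i k) H (s ∷ σ') {r} br = lift (lookup σ i) refl (found (lookup σ i))
    where
    σ = s ∷ σ'
    r₀ = writeHead (readHead r) r
    o = over σ i

    Goal : Str → Set
    Goal v = ∃[ r' ] Blanks r' × (at home , lay σ , r) ⟶⟨ 4 * size σ + 5 ⟩
      (k (head v) , lay (σ [ i ]≔ drop 1 v) , r')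

    Found : Str → Set
    Found v = ∃[ r' ] Blanks r' × (at look , doMove L (enc v ++ under σ i) (sep ∷ o ++ r₀)) ⟶⟨ 3 * suc (length o) + 3 ⟩
      (k (head v) , (o ʳ++ (sep ∷ enc (drop 1 v) ++ under σ i)) , r')

    -- The stack content is generalised to `v`, so that `found` can match on it while the remaining
    -- occurrences of `lookup σ i` stay as they are.
    lift : ∀ v → v ≡ lookup σ i → Found v → Goal v
    lift v eq (r' , br' , p) = r' , br' , subst (λ w → _ ⟶⟨ _ ⟩ (_ , w , r')) (over-lay-under σ i (drop 1 v))
      (reach-weaken (pop-time (length o) (size σ) _ (over-length σ i) ≤-refl)
        (go (H home _) (seek-run (λ j → H (seek j)) σ i i refl
          (subst (λ w → (at look , doMove L (enc w ++ under σ i) (sep ∷ o ++ r₀)) ⟶⟨ 3 * suc (length o) + 3 ⟩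
            (k (head v) , (o ʳ++ (sep ∷ enc (drop 1 v) ++ under σ i)) , r')) eq p))))

    empty-time : ∀ n → suc (suc (suc (suc n))) ≤ 3 * suc n + 3
    empty-time n = ≤-trans (≤-reflexive (+-comm 3 (suc n))) (+-monoˡ-≤ 3 (m≤m+n (suc n) _))

    found : ∀ v → Found v
    found [] with under σ i | under-shape σ i
    ... | _ | inj₁ refl
      with r' , br' , p ← return-run (H back) (sep ∷ o) {[]} ((λ ()) ∷ over-marks σ i) (refresh br) =
      r' , br' , reach-weaken (≤-trans (n≤1+n _) (empty-time (length o))) (go (H look sep) p)
    ... | _ | inj₂ (u , refl)
      with r' , br' , p ← return-run (H back) (sep ∷ sep ∷ o) {u} ((λ ()) ∷ (λ ()) ∷ over-marks σ i) (refresh br) =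
      r' , br' , reach-weaken (empty-time (length o)) (go (H look sep) p)
    found (false ∷ v)
      with r' , br' , p ← delete-run false H s0 (sep ∷ o) {enc v ++ under σ i} ((λ ()) ∷ over-marks σ i) (refresh br) =
      r' , br' , reach-weaken (≤-reflexive (sym (+-suc (3 * suc (length o)) 2))) (go (H look s0) p)
    found (true ∷ v)
      with r' , br' , p ← delete-run true H s1 (sep ∷ o) {enc v ++ under σ i} ((λ ()) ∷ over-marks σ i) (refresh br) =
      r' , br' , reach-weaken (≤-reflexive (sym (+-suc (3 * suc (length o)) 2))) (go (H look s1) p)

-- Programs

infixr 1 _>>=_ _>>_

-- Intermediate results live in the finite control, hence the `Listable` constraints. Loops are
-- unrestricted; termination and time are proved for individual runs through `Exec`.
data Prog (K : ℕ) : Set → Set₁ where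
  ret   : {A : Set} → A → Prog K A
  push  : Fin K → Bool → Prog K ⊤
  pop   : Fin K → Prog K (Maybe Bool)
  _>>=_ : {A B : Set} {{_ : Listable A}} → Prog K A → (A → Prog K B) → Prog K B
  iter  : {A B : Set} {{_ : Listable A}} → (A → Prog K (A ⊎ B)) → A → Prog K B

_>>_ : ∀ {K} {B : Set} → Prog K ⊤ → Prog K B → Prog K B
p >> q = p >>= λ _ → q

States : ∀ {K A} → Prog K A → Set
States (ret a)          = ⊤
States (push i b)       = ⊤
States (pop i)          = ⊤
States (_>>=_ {A} p k)  = States p ⊎ Σ A (λ a → States (k a))
States (iter {A} f _)   = Σ A (λ a → States (f a))

states-listable : ∀ {K A} (p : Prog K A) → Listable (States p)
states-listable (ret a)        = listable-⊤
states-listable (push i b)     = listable-⊤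
states-listable (pop i)        = listable-⊤
states-listable (_>>=_ {{l}} p k)  =
  listable-⊎ {{states-listable p}} {{listable-Σ l (λ a → states-listable (k a))}}
states-listable (iter {{l}} f _) = listable-Σ l (λ a → states-listable (f a))

entry : ∀ {K A} (p : Prog K A) → States p
entry (ret a)    = tt
entry (push i b) = tt
entry (pop i)    = tt
entry (p >>= k)  = inj₁ (entry p)
entry (iter f a) = a , entry (f a)

module _ {K A B} (p : Prog K A) (k : A → Prog K B) where
  in-bind : States p ⊎ A → (States p ⊎ Σ A (λ a → States (k a))) ⊎ B
  in-bind (inj₁ s) = inj₁ (inj₁ s)
  in-bind (inj₂ a) = inj₁ (inj₂ (a , entry (k a)))

  after-bind : ∀ a → States (k a) ⊎ B → (States p ⊎ Σ A (λ a → States (k a))) ⊎ B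
  after-bind a (inj₁ s) = inj₁ (inj₂ (a , s))
  after-bind a (inj₂ b) = inj₂ b

module _ {K} {A B : Set} (f : A → Prog K (A ⊎ B)) where
  in-iter : ∀ a → States (f a) ⊎ (A ⊎ B) → Σ A (λ a → States (f a)) ⊎ B
  in-iter a (inj₁ s)         = inj₁ (a , s)
  in-iter a (inj₂ (inj₁ a')) = inj₁ (a' , entry (f a'))
  in-iter a (inj₂ (inj₂ b))  = inj₂ b

next : ∀ {K A} (p : Prog K A) → States p → Instr K (States p ⊎ A)
next (ret a) _                 = nop (inj₂ a)
next (push i b) _              = psh i b (inj₂ tt)
next (pop i) _                 = pp i inj₂
next (p >>= k) (inj₁ s)        = mapI (in-bind p k) (next p s)
next (p >>= k) (inj₂ (a , s))  = mapI (after-bind p k a) (next (k a) s)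
next (iter f _) (a , s)        = mapI (in-iter f a) (next (f a) s)

module _ {K : ℕ} {T A : Set} (nxt : T → Instr K (T ⊎ A)) where
  data Path : (T ⊎ A) × Store K → ℕ → (T ⊎ A) × Store K → Set where
    stop : ∀ {c n} → Path c n c
    go   : ∀ {s σ n c} → Path (apply (nxt s) σ) n c → Path (inj₁ s , σ) (suc n) c

path-weaken : ∀ {K T A} {nxt : T → Instr K (T ⊎ A)} {c c' m n} → m ≤ n → Path nxt c m c' → Path nxt c n c'
path-weaken m≤n stop = stop
path-weaken (s≤s m≤n) (go p) = go (path-weaken m≤n p)

path-trans : ∀ {K T A} {nxt : T → Instr K (T ⊎ A)} {c c' c'' m n} →
             Path nxt c m c' → Path nxt c' n c'' → Path nxt c (m + n) c''
path-trans {m = m} {n} stop p = path-weaken (m≤n+m n m) p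
path-trans (go p) p' = go (path-trans p p')

apply-mapI : ∀ {K} {T T' : Set} (g : T → T') (I : Instr K T) σ →
             apply (mapI g I) σ ≡ (g (proj₁ (apply I σ)) , proj₂ (apply I σ))
apply-mapI g (nop t) σ     = refl
apply-mapI g (psh i b t) σ = refl
apply-mapI g (pp i k) σ    = refl

-- Embeds a run of a part into the whole. On running states `g` has to agree with `emb`, but it may
-- send a result of the part to a running state of the whole, as `in-bind` does when it enters the
-- second program.
path-map : ∀ {K T A T' A'} {nxt : T → Instr K (T ⊎ A)} {nxt' : T' → Instr K (T' ⊎ A')}
  (emb : T → T') (g : T ⊎ A → T' ⊎ A') → (∀ s → g (inj₁ s) ≡ inj₁ (emb s)) →
  (∀ s → nxt' (emb s) ≡ mapI g (nxt s)) →
  ∀ {x σ n y σ'} → Path nxt (x , σ) n (y , σ') → Path nxt' (g x , σ) n (g y , σ')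
path-map emb g e H stop = stop
path-map {nxt = nxt} {nxt'} emb g e H {σ' = σ'} (go {s} {σ} {n} p) rewrite e s =
  go (subst (λ c → Path nxt' c n (g _ , σ'))
       (sym (trans (cong (λ I → apply I σ) (H s)) (apply-mapI g (nxt s) σ)))
       (path-map emb g e H p))

-- A record and not a synonym for `Path`, so that unification can read off the program, which could
-- not be recovered from `next p`.
record Exec {K A} (p : Prog K A) (σ : Store K) (a : A) (σ' : Store K) (n : ℕ) : Set where
  constructor exec
  field path : Path (next p) (inj₁ (entry p) , σ) n (inj₂ a , σ')

open Exec

module _ {K : ℕ} where

  exec-weaken : ∀ {A} {p : Prog K A} {σ a σ' m n} → m ≤ n → Exec p σ a σ' m → Exec p σ a σ' n
  exec-weaken m≤n e = exec (path-weaken m≤n (path e))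

  exec-ret : ∀ {A σ} {a : A} → Exec {K} (ret a) σ a σ 1
  exec-ret = exec (go stop)

  exec-push : ∀ {i b σ} → Exec {K} (push i b) σ tt (σ [ i ]≔ (b ∷ lookup σ i)) 1
  exec-push = exec (go stop)

  exec-pop : ∀ {i σ} → Exec {K} (pop i) σ (head (lookup σ i)) (σ [ i ]≔ drop 1 (lookup σ i)) 1
  exec-pop = exec (go stop)

  infixr 4 _then_
  _then_ : ∀ {A B} {{_ : Listable A}} {p : Prog K A} {k : A → Prog K B} {σ a σ' b σ'' m n} →
           Exec p σ a σ' m → Exec (k a) σ' b σ'' n → Exec (p >>= k) σ b σ'' (m + n)
  _then_ {p = p} {k} {a = a} e e' = exec (path-trans
    (path-map inj₁ (in-bind p k) (λ _ → refl) (λ _ → refl) (path e))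
    (path-map (λ s → inj₂ (a , s)) (after-bind p k a) (λ _ → refl) (λ _ → refl) (path e')))

  -- The transition function of `iter f a` does not depend on `a`, which only selects the entry
  -- state. So the remaining iterations are transported along the identity, up to the harmless extra
  -- `mapI`.
  exec-again : ∀ {A B} {{_ : Listable A}} {f : A → Prog K (A ⊎ B)} {σ a a' σ' b σ'' m n} →
    Exec (f a) σ (inj₁ a') σ' m → Exec (iter f a') σ' b σ'' n → Exec (iter f a) σ b σ'' (m + n)
  exec-again {f = f} {a = a} {a'} e e' = exec (path-trans
    (path-map (a ,_) (in-iter f a) (λ _ → refl) (λ _ → refl) (path e))
    (path-map (λ s → s) (λ s → s) (λ _ → refl) (λ (b , s) → mapI-id (next (f b) s)) (path e')))
    where
    mapI-id : ∀ {T T' : Set} {g : T → T'} (I : Instr K T) → mapI g I ≡ mapI (λ s → s) (mapI g I)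
    mapI-id (nop x)     = refl
    mapI-id (psh i b x) = refl
    mapI-id (pp i k)    = refl

  exec-leave : ∀ {A B} {{_ : Listable A}} {f : A → Prog K (A ⊎ B)} {σ a b σ' m} →
    Exec (f a) σ (inj₂ b) σ' m → Exec (iter f a) σ b σ' m
  exec-leave {f = f} {a = a} e = exec (path-map (a ,_) (in-iter f a) (λ _ → refl) (λ _ → refl) (path e))

-- Compilation to Turing machines

enc-ʳ++ : ∀ s t {r} → enc s ʳ++ (enc t ++ r) ≡ enc (s ʳ++ t) ++ r
enc-ʳ++ [] t          = refl
enc-ʳ++ (false ∷ s) t = enc-ʳ++ s (false ∷ t)
enc-ʳ++ (true ∷ s) t  = enc-ʳ++ s (true ∷ t)

size-update : ∀ {K} (σ : Store K) i v → length v ≤ suc (length (lookup σ i)) → size (σ [ i ]≔ v) ≤ suc (size σ)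
size-update (s ∷ σ) zero v h
  rewrite length-++ (enc v) {lay σ} | length-++ (enc s) {lay σ} | length-enc v | length-enc s =
  s≤s (+-monoˡ-≤ (size σ) h)
size-update (s ∷ σ) (suc i) v h rewrite length-++ (enc s) {lay (σ [ i ]≔ v)} | length-++ (enc s) {lay σ} =
  s≤s (≤-trans (+-monoʳ-≤ (length (enc s)) (size-update σ i v h)) (≤-reflexive (+-suc _ _)))

size-apply : ∀ {K} {T : Set} (I : Instr K T) σ → size (proj₂ (apply I σ)) ≤ suc (size σ)
size-apply (nop t) σ     = n≤1+n _
size-apply (psh i b t) σ = size-update σ i _ ≤-refl
size-apply (pp i k) σ    = size-update σ i _ (≤-trans (drop-≤ (lookup σ i)) (n≤1+n _))
  where
  drop-≤ : (s : Str) → length (drop 1 s) ≤ length s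
  drop-≤ []      = z≤n
  drop-≤ (_ ∷ s) = n≤1+n _

size-path : ∀ {K T A} {nxt : T → Instr K (T ⊎ A)} {x σ n y σ'} →
            Path nxt (x , σ) n (y , σ') → size σ' ≤ size σ + n
size-path stop = m≤m+n _ _
size-path {nxt = nxt} (go {s} {σ} {n} p) = ≤-trans (size-path p)
  (≤-trans (+-monoˡ-≤ n (size-apply (nxt s) σ)) (≤-reflexive (sym (+-suc (size σ) n))))

-- `scan` runs to the end of the input and `fill` appends separators for the stacks that start
-- empty. After the program, `out₀`, `out₁` and `out₂` bring the head to the bottom of stack 0, so
-- that the tape from the head on shows that stack from bottom to top, followed by its separator.
data Control (T : Set) (K e : ℕ) : Set where
  scan           : Control T K e
  fill           : Fin (suc e) → Control T K e
  main           : T → Phase K → Control T K e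
  out₀ out₁ out₂ : Bool → Control T K e
  final          : Bool → Control T K e

listable-Control : ∀ {T K e} → Listable T → Listable (Control T K e)
listable-Control {T} {K} {e} LT = listing
  (scan ∷ map fill (allFin (suc e)) ++ mains ++ map out₀ elements ++ map out₁ elements ++
   map out₂ elements ++ map final elements)
  λ where
    scan        → here refl
    (fill j)    → there (∈-++⁺ˡ (∈-map⁺ fill (∈-allFin j)))
    (main s ph) → skip₁ (∈-++⁺ˡ (∈-map⁺ (λ (s , ph) → main s ph) (complete {{LTP}} (s , ph))))
    (out₀ b)    → skip₁ (∈-++⁺ʳ mains (∈-++⁺ˡ (∈-map⁺ out₀ (complete b))))
    (out₁ b)    → skip₁ (∈-++⁺ʳ mains (∈-++⁺ʳ (map out₀ elements) (∈-++⁺ˡ (∈-map⁺ out₁ (complete b)))))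
    (out₂ b)    → skip₁ (∈-++⁺ʳ mains (∈-++⁺ʳ (map out₀ elements) (∈-++⁺ʳ (map out₁ elements)
                    (∈-++⁺ˡ (∈-map⁺ out₂ (complete b))))))
    (final b)   → skip₁ (∈-++⁺ʳ mains (∈-++⁺ʳ (map out₀ elements) (∈-++⁺ʳ (map out₁ elements)
                    (∈-++⁺ʳ (map out₂ elements) (∈-map⁺ final (complete b))))))
  where
  LTP : Listable (T × Phase K)
  LTP = listable-Σ LT (λ _ → listable-Phase)
  mains : List (Control T K e)
  mains = map (λ (s , ph) → main s ph) (elements {{LTP}})
  skip₁ : ∀ {x xs} → x ∈ xs → x ∈ scan ∷ map fill (allFin (suc e)) ++ xs
  skip₁ p = there (∈-++⁺ʳ (map fill (allFin (suc e))) p)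

-- The summands pay for scanning, filling, the `c` instructions and the exit. As an instruction adds
-- at most one cell, the store never exceeds `e + m + c`.
compile-time : ℕ → ℕ → ℕ → ℕ
compile-time e c m = suc m + (suc e + (c * (4 * (e + m + c) + 5) + (3 + (e + m + c))))

-- There are at least two stacks because `out₂` walks left until it meets a separator: that of stack
-- 1. The deepest stack has none on its far side.
module _ {k : ℕ} (e : ℕ) (p : Prog (2 + k) Bool) where

  private
    K : ℕ
    K = 2 + k

    Q : Set
    Q = Control (States p) K e

    goto : States p ⊎ Bool → Q
    goto (inj₁ s) = main s home
    goto (inj₂ a) = out₀ a

    table : Table Q
    table scan blank     = just (fill (fromℕ e) , blank , S)
    table scan c         = just (scan , c , R)
    table (fill zero) c  = just (main (entry p) home , c , S)
    table (fill (suc j)) c = just (fill (inject₁ j) , sep , R)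
    table (main s ph) c  = just (move (main s) (mapI goto (next p s)) ph c)
    table (out₀ a) c     = just (out₁ a , c , L)
    table (out₁ a) c     = just (out₂ a , c , L)
    table (out₂ a) sep   = just (final a , sep , R)
    table (out₂ a) c     = just (out₂ a , c , L)
    table (final a) c    = nothing

    accept : Q → Bool
    accept (final a) = a
    accept _         = false

    control : Listable Q
    control = listable-Control (states-listable p)

    infix 4 _⟶⟨_⟩_
    _⟶⟨_⟩_ : Q × Tape → ℕ → Q × Tape → Set
    _⟶⟨_⟩_ = Reach table

    scan-run : ∀ w {l} → Marks w → (scan , l , w) ⟶⟨ suc (length w) ⟩ (fill (fromℕ e) , (w ʳ++ l) , [ blank ])
    scan-run [] []               = go refl stop
    scan-run (s0 ∷ w) (_ ∷ ms)    = go refl (scan-run w ms)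
    scan-run (s1 ∷ w) (_ ∷ ms)    = go refl (scan-run w ms)
    scan-run (sep ∷ w) (_ ∷ ms)   = go refl (scan-run w ms)
    scan-run (blank ∷ w) (m ∷ ms) = contradiction refl m

    replicate-comm : ∀ n {l} → replicate n sep ++ sep ∷ l ≡ sep ∷ replicate n sep ++ l
    replicate-comm zero    = refl
    replicate-comm (suc n) = cong (sep ∷_) (replicate-comm n)

    drop-blanks : ∀ {r} → Blanks r → Blanks (drop 1 r)
    drop-blanks []       = []
    drop-blanks (_ ∷ br) = br

    fill-run : ∀ n j {l r} → toℕ j ≡ n → Blanks r → ∃[ r' ] Blanks r' ×
      (fill j , l , r) ⟶⟨ suc n ⟩ (main (entry p) home , replicate n sep ++ l , r')
    fill-run zero zero _ []         = _ , refl ∷ [] , go refl stop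
    fill-run zero zero _ (refl ∷ br) = _ , refl ∷ br , go refl stop
    fill-run (suc n) (suc j) {l} eq br
      with r' , br' , q ← fill-run n (inject₁ j) {sep ∷ l} (trans (toℕ-inject₁ j) (suc-injective eq)) (drop-blanks br) =
      r' , br' , go refl (subst₂ (λ u v → (fill (inject₁ j) , u) ⟶⟨ suc n ⟩ (main (entry p) home , v , r'))
                           (shape br) (replicate-comm n) q)
      where
      shape : ∀ {r} → Blanks r → (sep ∷ l , drop 1 r) ≡ doMove R l (writeHead sep r)
      shape []       = refl
      shape (_ ∷ br) = refl

    main-run : ∀ {x σ n a σ' r} → Path (next p) (x , σ) n (inj₂ a , σ') → Blanks r → ∃[ r' ] Blanks r' ×
      (goto x , lay σ , r) ⟶⟨ n * (4 * (size σ + n) + 5) ⟩ (out₀ a , lay σ' , r')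
    main-run stop br = _ , br , stop
    main-run {r = r} (go {s} {σ} {n} q) br
      with r₁ , br₁ , q₁ ← instr-run {at = main s} {δ = table} (mapI goto (next p s)) (λ _ _ → refl) σ br
      rewrite apply-mapI goto (next p s) σ
      with r₂ , br₂ , q₂ ← main-run q br₁ =
      r₂ , br₂ , reach-weaken time (q₁ ◅◅ q₂)
      where
      grow : size σ + suc n ≡ suc (size σ) + n
      grow = +-suc (size σ) n
      time : 4 * size σ + 5 + n * (4 * (size (proj₂ (apply (next p s) σ)) + n) + 5) ≤ suc n * (4 * (size σ + suc n) + 5)
      time rewrite grow = +-mono-≤ (+-monoˡ-≤ 5 (*-monoʳ-≤ 4 (≤-trans (n≤1+n _) (m≤m+n _ n))))
        (*-monoʳ-≤ n (+-monoˡ-≤ 5 (*-monoʳ-≤ 4 (+-monoˡ-≤ n (size-apply (next p s) σ)))))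

    walk-out : ∀ a s {l r} →
      (out₂ a , doMove L (enc s ++ sep ∷ l) r) ⟶⟨ suc (length s) ⟩ (final a , sep ∷ l , (enc s ʳ++ r))
    walk-out a []          = go refl stop
    walk-out a (false ∷ s) = go refl (walk-out a s)
    walk-out a (true ∷ s)  = go refl (walk-out a s)

    exit-run : ∀ a s {l r} → Blanks r → ∃[ r' ]
      (out₀ a , (sep ∷ enc s ++ sep ∷ l) , r) ⟶⟨ 3 + length s ⟩ (final a , sep ∷ l , (enc s ʳ++ sep ∷ r'))
    exit-run a s br = _ , go refl (go refl (walk-out a s))

    machine : TM
    machine = toTM {{control}} scan table accept

    readBits-enc : ∀ s {r} → readBits (enc s ++ sep ∷ r) ≡ s
    readBits-enc []          = refl
    readBits-enc (false ∷ s) = cong (false ∷_) (readBits-enc s)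
    readBits-enc (true ∷ s)  = cong (true ∷_) (readBits-enc s)

    -- When `fill` ends, the part left of the head is `replicate e sep ++ reverse w`. The equation
    -- says that this is already the layout of a store, so the input is never copied.
    machine-correct : ∀ {σ a s s' σ₁ c w T} → Exec p σ a (s ∷ s' ∷ σ₁) c → Marks w →
      replicate e sep ++ reverse w ≡ lay σ → compile-time e c (length w) ≤ T →
      HaltsWithin machine T w × acceptsIn machine T w ≡ a × outputIn machine T w ≡ reverse s
    machine-correct {σ} {a} {s} {s'} {σ₁} {c} {w} {T} x mw eq c≤T
      = let (h , acc , out) = toTM-reach {{control}} scan table accept walk refl (≤-trans time c≤T)
        in h , acc , trans out (trans (cong readBits (enc-ʳ++ s [])) (readBits-enc (reverse s)))
      where
      filled = fill-run e (fromℕ e) {reverse w} (toℕ-fromℕ e) (refl ∷ [])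
      ran    = main-run (path x) (proj₁ (proj₂ filled))
      walk   = scan-run w mw ◅◅ subst (λ l → _ ⟶⟨ _ ⟩ (_ , l , proj₁ filled)) eq (proj₂ (proj₂ filled))
               ◅◅ proj₂ (proj₂ ran) ◅◅ proj₂ (exit-run a s {enc s' ++ lay σ₁} (proj₁ (proj₂ ran)))
      size-σ : size σ ≡ e + length w
      size-σ = trans (cong length (sym eq)) (trans (length-++ (replicate e sep)) (cong₂ _+_ (length-replicate e) (length-reverse w)))
      s≤ : length s ≤ e + length w + c
      s≤ = ≤-trans (≤-trans (≤-reflexive (sym (length-enc s)))
          (≤-trans (m≤m+n _ _) (≤-trans (≤-reflexive (sym (length-++ (enc s)))) (n≤1+n _))))
        (subst (λ n → size (s ∷ s' ∷ σ₁) ≤ n + c) size-σ (size-path (path x)))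
      time : suc (length w) + (suc e + (c * (4 * (size σ + c) + 5) + (3 + length s))) ≤ compile-time e c (length w)
      time rewrite size-σ = +-monoʳ-≤ (suc (length w)) (+-monoʳ-≤ (suc e) (+-monoʳ-≤ (c * (4 * (e + length w + c) + 5)) (+-monoʳ-≤ 3 s≤)))

  -- Later statements mention compiled machines for concrete programs; their tables must not be
  -- unfolded, and `compile-correct` is all that is used of them.
  opaque
    compile : TM
    compile = machine

    compile-correct : ∀ {σ a s s' σ₁ c w T} → Exec p σ a (s ∷ s' ∷ σ₁) c → Marks w →
      replicate e sep ++ reverse w ≡ lay σ → compile-time e c (length w) ≤ T →
      HaltsWithin compile T w × acceptsIn compile T w ≡ a × outputIn compile T w ≡ reverse s
    compile-correct = machine-correct

-- Clearing and moving stacks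

module _ {K : ℕ} where

  -- With stores written as `σ [ i ]≔ s`, an induction over a loop can vary `s` and keep `σ` fixed.
  exec-pop-at : ∀ {i} (σ : Store K) s → Exec (pop i) (σ [ i ]≔ s) (head s) (σ [ i ]≔ drop 1 s) 1
  exec-pop-at {i} σ s =
    subst₂ (λ u v → Exec (pop i) (σ [ i ]≔ s) (head u) v 1) (lookup∘update i σ s)
      (trans ([]≔-idempotent σ i) (cong (λ u → σ [ i ]≔ drop 1 u) (lookup∘update i σ s))) exec-pop

  exec-push-at : ∀ {i b} (σ : Store K) s → Exec (push i b) (σ [ i ]≔ s) tt (σ [ i ]≔ (b ∷ s)) 1
  exec-push-at {i} {b} σ s = subst (λ v → Exec (push i b) (σ [ i ]≔ s) tt v 1)
    (trans ([]≔-idempotent σ i) (cong (λ u → σ [ i ]≔ (b ∷ u)) (lookup∘update i σ s))) exec-push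

  clearing : Maybe Bool → Prog K (⊤ ⊎ ⊤)
  clearing nothing  = ret (inj₂ tt)
  clearing (just _) = ret (inj₁ tt)

  clear : Fin K → Prog K ⊤
  clear i = iter (λ _ → pop i >>= clearing) tt

  exec-clear-at : ∀ {i} {σ : Store K} s → Exec (clear i) (σ [ i ]≔ s) tt (σ [ i ]≔ []) (2 * suc (length s))
  exec-clear-at {σ = σ} []      = exec-leave (exec-pop-at σ [] then exec-ret)
  exec-clear-at {σ = σ} (b ∷ s) = exec-weaken (≤-reflexive (sym (*-suc 2 (suc (length s)))))
    (exec-again (exec-pop-at σ (b ∷ s) then exec-ret) (exec-clear-at s))

  exec-clear : ∀ {i} {σ : Store K} → Exec (clear i) σ tt (σ [ i ]≔ []) (2 * suc (length (lookup σ i)))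
  exec-clear {i} {σ} = subst (λ v → Exec (clear i) v tt (σ [ i ]≔ []) (2 * suc (length (lookup σ i)))) ([]≔-lookup σ i) (exec-clear-at (lookup σ i))

  transferring : Fin K → Maybe Bool → Prog K (⊤ ⊎ ⊤)
  transferring j nothing  = ret (inj₂ tt)
  transferring j (just b) = push j b >> ret (inj₁ tt)

  transfer : Fin K → Fin K → Prog K ⊤
  transfer i j = iter (λ _ → pop i >>= transferring j) tt

  module _ {i j : Fin K} (i≢j : i ≢ j) {σ : Store K} where

    exec-pop-under : ∀ s t → Exec (pop i) ((σ [ i ]≔ s) [ j ]≔ t) (head s) ((σ [ i ]≔ drop 1 s) [ j ]≔ t) 1
    exec-pop-under s t = subst₂ (λ u v → Exec (pop i) u (head s) v 1)
      ([]≔-commutes σ j i (i≢j ∘ sym)) ([]≔-commutes σ j i (i≢j ∘ sym)) (exec-pop-at (σ [ j ]≔ t) s)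

    exec-push-under : ∀ {b s t} → Exec (push i b) ((σ [ i ]≔ s) [ j ]≔ t) tt ((σ [ i ]≔ (b ∷ s)) [ j ]≔ t) 1
    exec-push-under {b} {s} {t} = subst₂ (λ u v → Exec (push i b) u tt v 1)
      ([]≔-commutes σ j i (i≢j ∘ sym)) ([]≔-commutes σ j i (i≢j ∘ sym)) (exec-push-at (σ [ j ]≔ t) s)

    exec-transfer : ∀ s t →
      Exec (transfer i j) ((σ [ i ]≔ s) [ j ]≔ t) tt ((σ [ i ]≔ []) [ j ]≔ (s ʳ++ t)) (3 * length s + 2)
    exec-transfer [] t      = exec-leave (exec-pop-under [] t then exec-ret)
    exec-transfer (b ∷ s) t = exec-weaken (≤-reflexive (cong (_+ 2) (sym (*-suc 3 (length s)))))
      (exec-again (exec-pop-under (b ∷ s) t then exec-push-at (σ [ i ]≔ s) t then exec-ret) (exec-transfer s (b ∷ t)))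

-- Registers: three work stacks L, R, T and m further ones, which hold reversed strings.
-- L and R hold a simulated tape, two bits for each symbol.

pattern #L = zero
pattern #R = suc zero
pattern #T = suc (suc zero)
pattern reg i = suc (suc (suc i))

hi lo : Sym → Bool
hi s0    = false
hi s1    = false
hi sep   = true
hi blank = true
lo s0    = false
lo s1    = true
lo sep   = false
lo blank = true

unbits : Bool → Bool → Sym
unbits false false = s0
unbits false true  = s1
unbits true false  = sep
unbits true true   = blank

unbits-bits : ∀ s → unbits (hi s) (lo s) ≡ s
unbits-bits s0    = refl
unbits-bits s1    = refl
unbits-bits sep   = refl
unbits-bits blank = refl

codes : List Sym → Str
codes []      = []
codes (s ∷ l) = hi s ∷ lo s ∷ codes l

length-codes : ∀ l → length (codes l) ≡ 2 * length l
length-codes []      = refl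
length-codes (s ∷ l) = trans (cong (2 +_) (length-codes l)) (sym (*-suc 2 (length l)))

module _ {K : ℕ} where

  pushSym : Fin K → Sym → Prog K ⊤
  pushSym i s = push i (lo s) >> push i (hi s)

  popLow : Fin K → Bool → Maybe Bool → Prog K (Maybe Sym)
  popLow i a nothing  = ret nothing
  popLow i a (just b) = ret (just (unbits a b))

  popHigh : Fin K → Maybe Bool → Prog K (Maybe Sym)
  popHigh i nothing  = ret nothing
  popHigh i (just a) = pop i >>= popLow i a

  popSym : Fin K → Prog K (Maybe Sym)
  popSym i = pop i >>= popHigh i

  exec-pushSym : ∀ {i s} {σ : Store K} {l} → Exec (pushSym i s) (σ [ i ]≔ codes l) tt (σ [ i ]≔ codes (s ∷ l)) 2
  exec-pushSym {s = s} {σ} {l} = exec-push-at σ (codes l) then exec-push-at σ (lo s ∷ codes l)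

  exec-popSym : ∀ {i} {σ : Store K} l → Exec (popSym i) (σ [ i ]≔ codes l) (head l) (σ [ i ]≔ codes (drop 1 l)) 3
  exec-popSym {i} {σ} []      = exec-weaken (s≤s (s≤s z≤n)) (exec-pop-at σ [] then exec-ret)
  exec-popSym {i} {σ} (s ∷ l) =
    subst (λ u → Exec (popSym i) (σ [ i ]≔ codes (s ∷ l)) (just u) (σ [ i ]≔ codes l) 3) (unbits-bits s)
      (exec-pop-at σ (codes (s ∷ l)) then exec-pop-at σ (lo s ∷ codes l) then exec-ret)

-- Simulation of Turing machines

-- The simulation pops the scanned symbol before it consults `δ` and pushes it back on halting. An
-- empty right part thereby becomes a single explicit blank.
refreshed : List Sym → List Sym
refreshed r = writeHead (readHead r) r

module _ {m : ℕ} (M : TM) where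
  open TM M

  shift : Move → Sym → Prog (3 + m) ⊤
  shiftLeft : Sym → Maybe Sym → Prog (3 + m) ⊤
  shiftLeft s nothing  = pushSym #R s
  shiftLeft s (just a) = pushSym #R s >> pushSym #R a
  shift L s = popSym #L >>= shiftLeft s
  shift R s = pushSym #L s
  shift S s = pushSym #R s

  -- The value of `δ` is a separate argument, so that the program can be rewritten along an equation
  -- for that value.
  act : Fin Q → Sym → Maybe (Fin Q × Sym × Move) → Prog (3 + m) (Fin Q ⊎ Bool)
  act q c nothing              = pushSym #R c >> ret (inj₂ (accepting q))
  act q c (just (q' , s , mv)) = shift mv s >> ret (inj₁ q')

  actOn : Fin Q → Sym → Prog (3 + m) (Fin Q ⊎ Bool)
  actOn q c = act q c (δ q c)

  simulate : Fin Q → Prog (3 + m) Bool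
  simulate = iter λ q → popSym #R >>= λ c → actOn q (fromMaybe blank c)

  private
    head-readHead : ∀ r → fromMaybe blank (head r) ≡ readHead r
    head-readHead []      = refl
    head-readHead (_ ∷ _) = refl

    writeHead-drop : ∀ {s} r → writeHead s r ≡ s ∷ drop 1 r
    writeHead-drop []      = refl
    writeHead-drop (_ ∷ _) = refl

  module _ {t : Str} {ρ : Store m} where

    tapes : List Sym × List Sym → Store (3 + m)
    tapes (l , r) = codes l ∷ codes r ∷ t ∷ ρ

    exec-shift : ∀ mv {s} l r → Exec (shift mv s) (tapes (l , r)) tt (tapes (doMove mv l (s ∷ r))) 7
    exec-shift L [] r       = exec-weaken (m≤m+n 5 2) (exec-popSym {σ = tapes ([] , r)} [] then exec-pushSym {σ = tapes ([] , r)} {r})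
    exec-shift L {s} (c ∷ l) r =
      exec-popSym {σ = tapes (c ∷ l , r)} (c ∷ l) then exec-pushSym {σ = tapes (l , r)} {r} then exec-pushSym {σ = tapes (l , r)} {s ∷ r}
    exec-shift R l r       = exec-weaken (m≤m+n 2 5) (exec-pushSym {σ = tapes (l , r)} {l})
    exec-shift S l r       = exec-weaken (m≤m+n 2 5) (exec-pushSym {σ = tapes (l , r)} {r})

    exec-halt : ∀ {q} l r → δ q (readHead r) ≡ nothing →
      Exec (simulate q) (tapes (l , r)) (accepting q) (tapes (l , refreshed r)) 11
    exec-halt {q} l r eq rewrite writeHead-drop {readHead r} r = exec-weaken (m≤m+n 6 5) (exec-leave
      (exec-popSym {σ = tapes (l , r)} r then
       subst (λ p → Exec p _ _ _ 3)
         (trans (cong (act q (readHead r)) (sym eq)) (cong (actOn q) (sym (head-readHead r))))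
         (exec-pushSym {σ = tapes (l , r)} {drop 1 r} then exec-ret)))

    exec-move : ∀ {q q' s mv} l r {b σ n} → δ q (readHead r) ≡ just (q' , s , mv) →
      Exec (simulate q') (tapes (doMove mv l (writeHead s r))) b σ n →
      Exec (simulate q) (tapes (l , r)) b σ (11 + n)
    exec-move {q} {q'} {s} {mv} l r {b} {σ} {n} eq e rewrite writeHead-drop {s} r = exec-again
      (exec-popSym {σ = tapes (l , r)} r then
       subst (λ p → Exec p _ _ _ 8)
         (trans (cong (act q (readHead r)) (sym eq)) (cong (actOn q) (sym (head-readHead r))))
         (exec-shift mv l (drop 1 r) then exec-ret)) e

    -- A simulated step takes at most 11 instructions: 3 for popping the scanned symbol, 7 for the
    -- shift (a left move pops one symbol and pushes two) and 1 for the return. The additional round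
    -- is the one that notices the halt.
    exec-simulate : ∀ n q l r → let c = run M n (conf q l r) in Halted M c →
      Exec (simulate q) (tapes (l , r)) (accepting (Config.state c))
        (tapes (Config.left c , refreshed (Config.right c))) (11 * suc n)
    exec-simulate zero q l r h with δ q (readHead r) in eq
    ... | nothing = exec-halt l r eq
    exec-simulate (suc n) q l r h with δ q (readHead r) in eq
    ... | nothing             = exec-weaken (m≤m*n 11 (suc (suc n))) (exec-halt l r eq)
    ... | just (q' , s , mv)  = exec-weaken (≤-reflexive (sym (*-suc 11 (suc n))))
      (exec-move l r eq (exec-simulate n q' (proj₁ (doMove mv l (writeHead s r))) (proj₂ (doMove mv l (writeHead s r))) h))

tape-step : ∀ mv s l r →
  length (proj₁ (doMove mv l (writeHead s r))) + length (proj₂ (doMove mv l (writeHead s r))) ≤ suc (length l + length r)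
tape-step L s [] []           = ≤-refl
tape-step L s [] (x ∷ r)      = n≤1+n _
tape-step L s (c ∷ l) []      = ≤-reflexive (trans (+-comm (length l) 2) (cong (2 +_) (sym (+-identityʳ (length l)))))
tape-step L s (c ∷ l) (x ∷ r) = ≤-trans (≤-reflexive (+-suc (length l) _)) (n≤1+n _)
tape-step R s l []            = ≤-refl
tape-step R s l (x ∷ r)       = s≤s (+-monoʳ-≤ (length l) (n≤1+n _))
tape-step S s l []            = ≤-reflexive (+-suc (length l) 0)
tape-step S s l (x ∷ r)       = n≤1+n _

-- Needed for the cost of emptying `#L` and `#R` after a simulation.
tape-run : ∀ M n q l r → let c = run M n (conf q l r) in
  length (Config.left c) + length (Config.right c) ≤ length l + length r + n
tape-run M zero q l r = m≤m+n _ _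
tape-run M (suc n) q l r with TM.δ M q (readHead r)
... | nothing            = m≤m+n _ _
... | just (q' , s , mv) = ≤-trans (tape-run M n q' _ _)
  (≤-trans (+-monoˡ-≤ n (tape-step mv s l r)) (≤-reflexive (sym (+-suc _ n))))

ʳ++-reverse : (s : Str) → (s ʳ++ []) ʳ++ [] ≡ s
ʳ++-reverse s = trans (ʳ++-ʳ++ s) (++-identityʳ s)

enc-reverse-ʳ++ : ∀ s {r} → enc s ʳ++ r ≡ enc (reverse s) ++ r
enc-reverse-ʳ++ s = enc-ʳ++ s []

-- Subroutines: loading arguments, calling machines, comparing strings

agrees : Bool → Sym → Bool
agrees false s0 = true
agrees true s1  = true
agrees _ _      = false

compared : Bool → Bool → Maybe Sym → Bool
compared ok b nothing  = false
compared ok b (just s) = ok ∧ agrees b s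

isNothing : Maybe Sym → Bool
isNothing nothing  = true
isNothing (just _) = false

-- This is the loop `compare`. It runs on after a mismatch, with `ok` false, because every bit of
-- `t` still has to be returned to its register.
same? : Bool → Str → List Sym → Bool
same? ok [] r      = ok ∧ isNothing (head r)
same? ok (b ∷ t) r = same? (compared ok b (head r)) t (drop 1 r)

same?-false : ∀ t r → same? false t r ≡ false
same?-false [] r           = refl
same?-false (b ∷ t) []      = same?-false t []
same?-false (b ∷ t) (s ∷ r) = same?-false t r

same?-enc⇒≡ : ∀ t u → same? true t (enc u) ≡ true → t ≡ u
same?-enc⇒≡ [] [] eq = refl
same?-enc⇒≡ [] (false ∷ u) ()
same?-enc⇒≡ [] (true ∷ u) ()
same?-enc⇒≡ (b ∷ t) [] eq = contradiction (trans (sym (same?-false t [])) eq) λ ()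
same?-enc⇒≡ (false ∷ t) (false ∷ u) eq = cong (false ∷_) (same?-enc⇒≡ t u eq)
same?-enc⇒≡ (true ∷ t) (true ∷ u) eq   = cong (true ∷_) (same?-enc⇒≡ t u eq)
same?-enc⇒≡ (false ∷ t) (true ∷ u) eq  = contradiction (trans (sym (same?-false t (enc u))) eq) λ ()
same?-enc⇒≡ (true ∷ t) (false ∷ u) eq  = contradiction (trans (sym (same?-false t (enc u))) eq) λ ()

same?-refl : ∀ t → same? true t (enc t) ≡ true
same?-refl []          = refl
same?-refl (false ∷ t) = same?-refl t
same?-refl (true ∷ t)  = same?-refl t

module _ {m : ℕ} where

  private
    K : ℕ
    K = 3 + m

  loading : Maybe Bool → Prog K (⊤ ⊎ ⊤)
  loading nothing  = ret (inj₂ tt)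
  loading (just b) = push #T b >> pushSym #R (bit b) >> ret (inj₁ tt)

  -- A register yields the last bit of its string first, so the string arrives on `#R` in reading
  -- order. The copy on `#T` is what `load` restores the register from.
  unload : Fin m → Prog K ⊤
  unload i = iter (λ _ → pop (reg i) >>= loading) tt

  load : Fin m → Prog K ⊤
  load i = unload i >> transfer #T (reg i)

  exec-unload : ∀ {i l t} {ρ : Store m} s τ → Exec (unload i) (l ∷ codes τ ∷ t ∷ ρ [ i ]≔ s) tt
    (l ∷ codes (enc s ʳ++ τ) ∷ (s ʳ++ t) ∷ ρ [ i ]≔ []) (5 * length s + 2)
  exec-unload {i} {l} {t} {ρ} [] τ      = exec-leave (exec-pop-at (l ∷ codes τ ∷ t ∷ ρ) [] then exec-ret)
  exec-unload {i} {l} {t} {ρ} (b ∷ s) τ = exec-weaken (≤-reflexive (cong (_+ 2) (sym (*-suc 5 (length s)))))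
    (exec-again
      (exec-pop-at (l ∷ codes τ ∷ t ∷ ρ) (b ∷ s) then exec-push then
       exec-pushSym {σ = l ∷ [] ∷ (b ∷ t) ∷ ρ [ i ]≔ s} {τ} then exec-ret)
      (subst (λ τ' → Exec (unload i) (l ∷ codes (bit b ∷ τ) ∷ (b ∷ t) ∷ ρ [ i ]≔ s) tt
                       (l ∷ codes τ' ∷ (s ʳ++ (b ∷ t)) ∷ ρ [ i ]≔ []) (5 * length s + 2))
             (cong (_ʳ++ τ) (sym (enc-∷ b s)))
         (exec-unload s (bit b ∷ τ))))

  reg≢#T : ∀ {i : Fin m} → _≢_ {A = Fin K} (reg i) #T
  reg≢#T ()

  restore : ∀ {i l r} {ρ : Store m} t s → Exec (transfer #T (reg i)) (l ∷ r ∷ t ∷ ρ [ i ]≔ s) tt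
    (l ∷ r ∷ [] ∷ ρ [ i ]≔ (t ʳ++ s)) (3 * length t + 2)
  restore {i} {l} {r} {ρ} t s = exec-transfer (reg≢#T ∘ sym) {l ∷ r ∷ t ∷ ρ} t s

  drain : ∀ {i l r} {ρ : Store m} s t → Exec (transfer (reg i) #T) (l ∷ r ∷ t ∷ ρ [ i ]≔ s) tt
    (l ∷ r ∷ (s ʳ++ t) ∷ ρ [ i ]≔ []) (3 * length s + 2)
  drain {i} {l} {r} {ρ} s t = exec-transfer reg≢#T {l ∷ r ∷ [] ∷ ρ} s t

  content : Store m → Fin m → Str
  content ρ i = reverse (lookup ρ i)

  exec-load : ∀ {l} {ρ : Store m} i τ → Exec (load i) (l ∷ codes τ ∷ [] ∷ ρ) tt
    (l ∷ codes (enc (content ρ i) ++ τ) ∷ [] ∷ ρ) (8 * length (content ρ i) + 4)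
  exec-load {l} {ρ} i τ = subst₂ (λ u v → Exec (load i) u tt v (8 * length (content ρ i) + 4))
    (cong (λ u → l ∷ codes τ ∷ [] ∷ u) ([]≔-lookup ρ i))
    (cong₂ (λ u v → l ∷ codes u ∷ [] ∷ v) (enc-reverse-ʳ++ s)
      (trans (cong (ρ [ i ]≔_) (ʳ++-reverse s)) ([]≔-lookup ρ i)))
    (exec-weaken (≤-reflexive time) (exec-unload {i} {l} {[]} {ρ} s τ then restore (s ʳ++ []) []))
    where
    s = lookup ρ i
    arith : ∀ n → 5 * n + 2 + (3 * n + 2) ≡ 8 * n + 4
    arith = solve-∀
    time : 5 * length s + 2 + (3 * length (reverse s) + 2) ≡ 8 * length (content ρ i) + 4
    time rewrite length-reverse s = arith (length s)

  -- The arguments are loaded from last to first, since the top of `#R` is to be the left end of the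
  -- simulated input.
  loadAll : Fin m → List (Fin m) → Prog K ⊤
  loadAll i []       = load i
  loadAll i (j ∷ js) = loadAll j js >> pushSym #R sep >> load i

  inputTape : Store m → Fin m → List (Fin m) → List Sym
  inputTape ρ i []       = enc (content ρ i)
  inputTape ρ i (j ∷ js) = enc (content ρ i) ++ sep ∷ inputTape ρ j js

  exec-loadAll : ∀ {l} {ρ : Store m} i js → Exec (loadAll i js) (l ∷ [] ∷ [] ∷ ρ) tt
    (l ∷ codes (inputTape ρ i js) ∷ [] ∷ ρ) (8 * length (inputTape ρ i js) + 4)
  exec-loadAll {l} {ρ} i [] =
    subst₂ (λ u n → Exec (load i) (l ∷ [] ∷ [] ∷ ρ) tt (l ∷ codes u ∷ [] ∷ ρ) (8 * n + 4))
      (++-identityʳ _) (sym (length-enc (content ρ i))) (exec-load i [])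
  exec-loadAll {l} {ρ} i (j ∷ js) = exec-weaken (≤-trans (m≤m+n _ 2) (≤-reflexive time))
    (exec-loadAll {l} {ρ} j js then exec-pushSym {s = sep} {l ∷ [] ∷ [] ∷ ρ} {inputTape ρ j js} then
     exec-load i (sep ∷ inputTape ρ j js))
    where
    arith : ∀ a b → 8 * b + 4 + (2 + (8 * a + 4)) + 2 ≡ 8 * (a + suc b) + 4
    arith = solve-∀
    time : 8 * length (inputTape ρ j js) + 4 + (2 + (8 * length (content ρ i) + 4)) + 2
           ≡ 8 * length (inputTape ρ i (j ∷ js)) + 4
    time rewrite length-++ (enc (content ρ i)) {sep ∷ inputTape ρ j js} | length-enc (content ρ i) =
      arith (length (content ρ i)) (length (inputTape ρ j js))

  callPred : TM → Fin m → List (Fin m) → Prog K Bool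
  callPred M i js = loadAll i js >> simulate M (TM.start M) >>= λ v → clear #L >> clear #R >> ret v

  refreshed-length : ∀ r → length (refreshed r) ≤ suc (length r)
  refreshed-length []      = ≤-refl
  refreshed-length (x ∷ r) = n≤1+n _

  exec-callPred : ∀ {ρ : Store m} M n i js → HaltsWithin M n (inputTape ρ i js) →
    Exec (callPred M i js) ([] ∷ [] ∷ [] ∷ ρ) (acceptsIn M n (inputTape ρ i js)) ([] ∷ [] ∷ [] ∷ ρ)
      (32 * suc (length (inputTape ρ i js) + n))
  exec-callPred {ρ} M n i js h = exec-weaken time
    (exec-loadAll {[]} {ρ} i js then exec-simulate M n (TM.start M) [] w h then
     exec-clear {σ = codes l ∷ codes (refreshed r) ∷ [] ∷ ρ} then
     exec-clear {σ = [] ∷ codes (refreshed r) ∷ [] ∷ ρ} then exec-ret)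
    where
    w = inputTape ρ i js
    c = run M n (conf (TM.start M) [] w)
    l = Config.left c
    r = Config.right c
    clearTime : ∀ a b → a + b ≤ length w + n →
      2 * suc (2 * a) + (2 * suc (2 * suc b) + 1) ≤ 4 * (length w + n) + 9
    clearTime a b h = ≤-trans (≤-reflexive (arith a b)) (+-monoˡ-≤ 9 (*-monoʳ-≤ 4 h))
      where
      arith : ∀ a b → 2 * suc (2 * a) + (2 * suc (2 * suc b) + 1) ≡ 4 * (a + b) + 9
      arith = solve-∀
    -- The last summand is slack that rounds the cost up to a multiple of `suc (w + n)`.
    total : ∀ w n → 8 * w + 4 + (11 * suc n) + (4 * (w + n) + 9) + (20 * w + 17 * n + 8) ≡ 32 * suc (w + n)
    total = solve-∀
    time : 8 * length w + 4 + (11 * suc n + (2 * suc (length (codes l)) + (2 * suc (length (codes (refreshed r))) + 1)))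
           ≤ 32 * suc (length w + n)
    time rewrite length-codes l | length-codes (refreshed r) = begin
      8 * length w + 4 + (11 * suc n + (2 * suc (2 * length l) + (2 * suc (2 * length (refreshed r)) + 1)))
        ≡⟨ +-assoc (8 * length w + 4) (11 * suc n) _ ⟨
      8 * length w + 4 + 11 * suc n + (2 * suc (2 * length l) + (2 * suc (2 * length (refreshed r)) + 1))
        ≤⟨ +-monoʳ-≤ (8 * length w + 4 + 11 * suc n) (+-monoʳ-≤ (2 * suc (2 * length l))
             (+-monoˡ-≤ 1 (*-monoʳ-≤ 2 (s≤s (*-monoʳ-≤ 2 (refreshed-length r)))))) ⟩
      8 * length w + 4 + 11 * suc n + (2 * suc (2 * length l) + (2 * suc (2 * suc (length r)) + 1))
        ≤⟨ +-monoʳ-≤ (8 * length w + 4 + 11 * suc n) (clearTime (length l) (length r) (tape-run M n (TM.start M) [] w)) ⟩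
      8 * length w + 4 + 11 * suc n + (4 * (length w + n) + 9)
        ≤⟨ m≤m+n _ _ ⟩
      8 * length w + 4 + 11 * suc n + (4 * (length w + n) + 9) + (20 * length w + 17 * n + 8)
        ≡⟨ total (length w) n ⟩
      32 * suc (length w + n) ∎
      where open ≤-Reasoning

  fetching : Fin m → Maybe Sym → Prog K (⊤ ⊎ ⊤)
  fetching o (just s0) = push (reg o) false >> ret (inj₁ tt)
  fetching o (just s1) = push (reg o) true >> ret (inj₁ tt)
  fetching o _         = ret (inj₂ tt)

  fetch : Fin m → Prog K ⊤
  fetch o = iter (λ _ → popSym #R >>= fetching o) tt

  -- Pushing output bits in reading order leaves them reversed, as registers require. Of the
  -- remaining tape only the length is recorded, since it is going to be cleared.
  exec-fetch : ∀ {o l t} {ρ : Store m} r s → ∃[ r' ] length r' ≤ length r ×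
    Exec (fetch o) (l ∷ codes r ∷ t ∷ ρ [ o ]≔ s) tt (l ∷ codes r' ∷ t ∷ ρ [ o ]≔ (readBits r ʳ++ s)) (5 * suc (length r))
  exec-fetch {o} {l} {t} {ρ} [] s =
    _ , ≤-refl , exec-weaken (n≤1+n 4) (exec-leave (exec-popSym {σ = l ∷ [] ∷ t ∷ ρ [ o ]≔ s} [] then exec-ret))
  exec-fetch {o} {l} {t} {ρ} (sep ∷ r) s =
    _ , n≤1+n _ , exec-weaken (≤-trans (n≤1+n 4) (m≤m*n 5 (suc (suc (length r)))))
      (exec-leave (exec-popSym {σ = l ∷ [] ∷ t ∷ ρ [ o ]≔ s} (sep ∷ r) then exec-ret))
  exec-fetch {o} {l} {t} {ρ} (blank ∷ r) s =
    _ , n≤1+n _ , exec-weaken (≤-trans (n≤1+n 4) (m≤m*n 5 (suc (suc (length r)))))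
      (exec-leave (exec-popSym {σ = l ∷ [] ∷ t ∷ ρ [ o ]≔ s} (blank ∷ r) then exec-ret))
  exec-fetch {o} {l} {t} {ρ} (s0 ∷ r) s with r' , r'≤r , e ← exec-fetch {o} {l} {t} {ρ} r (false ∷ s) =
    r' , ≤-trans r'≤r (n≤1+n _) , exec-weaken (≤-reflexive (sym (*-suc 5 (suc (length r)))))
      (exec-again (exec-popSym {σ = l ∷ [] ∷ t ∷ ρ [ o ]≔ s} (s0 ∷ r) then exec-push-at (l ∷ codes r ∷ t ∷ ρ) s then exec-ret) e)
  exec-fetch {o} {l} {t} {ρ} (s1 ∷ r) s with r' , r'≤r , e ← exec-fetch {o} {l} {t} {ρ} r (true ∷ s) =
    r' , ≤-trans r'≤r (n≤1+n _) , exec-weaken (≤-reflexive (sym (*-suc 5 (suc (length r)))))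
      (exec-again (exec-popSym {σ = l ∷ [] ∷ t ∷ ρ [ o ]≔ s} (s1 ∷ r) then exec-push-at (l ∷ codes r ∷ t ∷ ρ) s then exec-ret) e)

  callFun : TM → Fin m → Fin m → Prog K ⊤
  callFun M i o = loadAll i [] >> simulate M (TM.start M) >>= λ _ → fetch o >> clear #L >> clear #R

  readBits-refreshed : ∀ r → readBits (refreshed r) ≡ readBits r
  readBits-refreshed []      = refl
  readBits-refreshed (x ∷ r) = refl

  exec-callFun : ∀ {ρ : Store m} M n i o → lookup ρ o ≡ [] → HaltsWithin M n (enc (content ρ i)) →
    Exec (callFun M i o) ([] ∷ [] ∷ [] ∷ ρ) tt ([] ∷ [] ∷ [] ∷ ρ [ o ]≔ reverse (outputIn M n (enc (content ρ i))))
      (40 * suc (length (content ρ i) + n))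
  exec-callFun {ρ} M n i o empty h = exec-weaken time
    (exec-loadAll {[]} {ρ} i [] then exec-simulate M n (TM.start M) [] w h then
     subst₂ (λ u v → Exec (fetch o) (codes l ∷ codes (refreshed r) ∷ [] ∷ u) tt
                       (codes l ∷ codes r' ∷ [] ∷ ρ [ o ]≔ reverse v) (5 * suc (length (refreshed r))))
       (trans (cong (ρ [ o ]≔_) (sym empty)) ([]≔-lookup ρ o)) (readBits-refreshed r)
       (proj₂ (proj₂ fetched)) then
     exec-clear {σ = codes l ∷ codes r' ∷ [] ∷ ρ'} then
     exec-clear {σ = [] ∷ codes r' ∷ [] ∷ ρ'})
    where
    w = enc (content ρ i)
    c = run M n (conf (TM.start M) [] w)
    l = Config.left c
    r = Config.right c
    fetched = exec-fetch {o} {codes l} {[]} {ρ} (refreshed r) []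
    r' = proj₁ fetched
    ρ' = ρ [ o ]≔ reverse (outputIn M n w)
    arith : ∀ a b → 5 * suc (suc b) + (2 * suc (2 * a) + 2 * suc (2 * suc b)) + (5 * a) ≡ 9 * (a + b) + 18
    arith = solve-∀
    total : ∀ w n → 8 * w + 4 + (11 * suc n + (9 * (w + n) + 18)) + (23 * w + 20 * n + 7) ≡ 40 * suc (w + n)
    total = solve-∀
    time : 8 * length w + 4 + (11 * suc n + (5 * suc (length (refreshed r)) +
             (2 * suc (length (codes l)) + 2 * suc (length (codes r')))))
           ≤ 40 * suc (length (content ρ i) + n)
    time rewrite length-codes l | length-codes r' | sym (length-enc (content ρ i)) = begin
      8 * length w + 4 + (11 * suc n + (5 * suc (length (refreshed r)) + (2 * suc (2 * length l) + 2 * suc (2 * length r'))))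
        ≤⟨ +-monoʳ-≤ (8 * length w + 4) (+-monoʳ-≤ (11 * suc n) rest) ⟩
      8 * length w + 4 + (11 * suc n + (9 * (length w + n) + 18))
        ≤⟨ m≤m+n _ _ ⟩
      8 * length w + 4 + (11 * suc n + (9 * (length w + n) + 18)) + (23 * length w + 20 * n + 7)
        ≡⟨ total (length w) n ⟩
      40 * suc (length w + n) ∎
      where
      open ≤-Reasoning
      rest : 5 * suc (length (refreshed r)) + (2 * suc (2 * length l) + 2 * suc (2 * length r')) ≤ 9 * (length w + n) + 18
      rest = begin
        5 * suc (length (refreshed r)) + (2 * suc (2 * length l) + 2 * suc (2 * length r'))
          ≤⟨ +-mono-≤ (*-monoʳ-≤ 5 (s≤s (refreshed-length r))) (+-monoʳ-≤ (2 * suc (2 * length l))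
               (*-monoʳ-≤ 2 (s≤s (*-monoʳ-≤ 2 (≤-trans (proj₁ (proj₂ fetched)) (refreshed-length r)))))) ⟩
        5 * suc (suc (length r)) + (2 * suc (2 * length l) + 2 * suc (2 * suc (length r)))
          ≤⟨ m≤m+n _ (5 * length l) ⟩
        5 * suc (suc (length r)) + (2 * suc (2 * length l) + 2 * suc (2 * suc (length r))) + 5 * length l
          ≡⟨ arith (length l) (length r) ⟩
        9 * (length l + length r) + 18
          ≤⟨ +-monoˡ-≤ 18 (*-monoʳ-≤ 9 (tape-run M n (TM.start M) [] w)) ⟩
        9 * (length w + n) + 18 ∎

  comparing : Fin m → Bool → Maybe Bool → Prog K (Bool ⊎ Bool)
  comparing j ok nothing  = popSym #R >>= λ s → ret (inj₂ (ok ∧ isNothing s))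
  comparing j ok (just b) = push (reg j) b >> popSym #R >>= λ s → ret (inj₁ (compared ok b s))

  compare : Fin m → Bool → Prog K Bool
  compare j = iter λ ok → pop #T >>= comparing j ok

  exec-compare : ∀ {j l} {ρ : Store m} ok t r s → ∃[ r' ] length r' ≤ length r ×
    Exec (compare j ok) (l ∷ codes r ∷ t ∷ ρ [ j ]≔ s) (same? ok t r)
      (l ∷ codes r' ∷ [] ∷ ρ [ j ]≔ (t ʳ++ s)) (6 * length t + 5)
  exec-compare {j} {l} {ρ} ok [] r s = _ , drop-≤ r , exec-leave
    (exec-pop {σ = l ∷ codes r ∷ [] ∷ ρ [ j ]≔ s} then exec-popSym {σ = l ∷ [] ∷ [] ∷ ρ [ j ]≔ s} r then exec-ret)
    where
    drop-≤ : ∀ r → length (drop 1 r) ≤ length r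
    drop-≤ []      = z≤n
    drop-≤ (_ ∷ r) = n≤1+n _
  exec-compare {j} {l} {ρ} ok (b ∷ t) r s
    with r' , r'≤r , e ← exec-compare {j} {l} {ρ} (compared ok b (head r)) t (drop 1 r) (b ∷ s) =
    r' , ≤-trans r'≤r (≤-trans (≤-reflexive (length-drop 1 r)) (m∸n≤m (length r) 1)) ,
    exec-weaken (≤-reflexive (cong (_+ 5) (sym (*-suc 6 (length t)))))
      (exec-again (exec-pop {σ = l ∷ codes r ∷ (b ∷ t) ∷ ρ [ j ]≔ s} then
                   exec-push-at (l ∷ codes r ∷ t ∷ ρ) s then
                   exec-popSym {σ = l ∷ [] ∷ t ∷ ρ [ j ]≔ (b ∷ s)} r then exec-ret) e)

  equal : Fin m → Fin m → Prog K Bool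
  equal i j = loadAll i [] >> transfer (reg j) #T >> compare j true >>= λ v → clear #R >> ret v

  exec-equal : ∀ {ρ : Store m} i j →
    Exec (equal i j) ([] ∷ [] ∷ [] ∷ ρ) (same? true (content ρ j) (enc (content ρ i))) ([] ∷ [] ∷ [] ∷ ρ)
      (14 * suc (length (content ρ i) + length (content ρ j)))
  exec-equal {ρ} i j = subst (λ σ → Exec (equal i j) ([] ∷ [] ∷ [] ∷ ρ) (same? true t w) σ (14 * suc (length (content ρ i) + length t)))
    (cong (λ σ → [] ∷ [] ∷ [] ∷ σ) (trans (cong (ρ [ j ]≔_) (ʳ++-reverse s)) ([]≔-lookup ρ j)))
    (exec-weaken time
      (exec-loadAll {[]} {ρ} i [] then
       subst (λ σ → Exec (transfer (reg j) #T) ([] ∷ codes w ∷ [] ∷ σ) tt ([] ∷ codes w ∷ t ∷ ρ [ j ]≔ []) (3 * length s + 2))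
         ([]≔-lookup ρ j) (drain {ρ = ρ} s []) then
       proj₂ (proj₂ cmp) then exec-clear {σ = [] ∷ codes r' ∷ [] ∷ ρ [ j ]≔ (t ʳ++ [])} then exec-ret))
    where
    s = lookup ρ j
    t = content ρ j
    w = enc (content ρ i)
    cmp = exec-compare {j} {[]} {ρ} true t w []
    r' = proj₁ cmp
    arith : ∀ a b → 8 * a + 4 + (3 * b + 2 + (6 * b + 5 + (2 * suc (2 * a) + 1))) + (2 * a + 5 * b) ≡ 14 * suc (a + b)
    arith = solve-∀
    time : 8 * length w + 4 + (3 * length s + 2 + (6 * length t + 5 + (2 * suc (length (codes r')) + 1)))
           ≤ 14 * suc (length (content ρ i) + length t)
    time rewrite length-codes r' | sym (length-reverse s) | sym (length-enc (content ρ i)) = begin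
      8 * length w + 4 + (3 * length t + 2 + (6 * length t + 5 + (2 * suc (2 * length r') + 1)))
        ≤⟨ +-monoʳ-≤ (8 * length w + 4) (+-monoʳ-≤ (3 * length t + 2) (+-monoʳ-≤ (6 * length t + 5)
             (+-monoˡ-≤ 1 (*-monoʳ-≤ 2 (s≤s (*-monoʳ-≤ 2 (proj₁ (proj₂ cmp)))))))) ⟩
      8 * length w + 4 + (3 * length t + 2 + (6 * length t + 5 + (2 * suc (2 * length w) + 1)))
        ≤⟨ m≤m+n _ _ ⟩
      8 * length w + 4 + (3 * length t + 2 + (6 * length t + 5 + (2 * suc (2 * length w) + 1))) + (2 * length w + 5 * length t)
        ≡⟨ arith (length w) (length t) ⟩
      14 * suc (length w + length t) ∎
      where open ≤-Reasoning

-- Interleaving of strings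

interleave : Str → Str → Str
interleave (a ∷ y) (b ∷ z) = a ∷ b ∷ interleave y z
interleave _ _             = []

evens odds : Str → Str
evens (a ∷ b ∷ w) = a ∷ evens w
evens _           = []
odds (a ∷ b ∷ w) = b ∷ odds w
odds _           = []

-- The effect of `join` on `#T`: two reversed strings are consumed from their last bits on, so the
-- accumulator ends up in reading order.
zipUp : Str → Str → Str → Str
zipUp (a ∷ u) (b ∷ v) t = zipUp u v (a ∷ b ∷ t)
zipUp _ _ t             = t

zipUp-∷ʳ : ∀ u v a b t → length u ≡ length v → zipUp (u ++ [ a ]) (v ++ [ b ]) t ≡ a ∷ b ∷ zipUp u v t
zipUp-∷ʳ [] [] a b t _            = refl
zipUp-∷ʳ (c ∷ u) (d ∷ v) a b t eq = zipUp-∷ʳ u v a b (c ∷ d ∷ t) (suc-injective eq)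

zipUp-reverse : ∀ y z t → length y ≡ length z → zipUp (reverse y) (reverse z) t ≡ interleave y z ++ t
zipUp-reverse [] [] t _ = refl
zipUp-reverse (a ∷ y) (b ∷ z) t eq
  rewrite unfold-reverse a y | unfold-reverse b z =
  trans (zipUp-∷ʳ (reverse y) (reverse z) a b t (trans (length-reverse y) (trans (suc-injective eq) (sym (length-reverse z)))))
        (cong (λ w → a ∷ b ∷ w) (zipUp-reverse y z t (suc-injective eq)))

module _ {m : ℕ} where

  splitOdd : Fin m → Fin m → Bool → Maybe Bool → Prog (3 + m) (⊤ ⊎ ⊤)
  splitOdd j k a nothing  = ret (inj₂ tt)
  splitOdd j k a (just b) = push (reg j) a >> push (reg k) b >> ret (inj₁ tt)

  splitEven : Fin m → Fin m → Maybe Bool → Prog (3 + m) (⊤ ⊎ ⊤)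
  splitEven j k nothing  = ret (inj₂ tt)
  splitEven j k (just a) = pop #T >>= splitOdd j k a

  split : Fin m → Fin m → Prog (3 + m) ⊤
  split j k = iter (λ _ → pop #T >>= splitEven j k) tt

  joinOdd : Bool → Maybe Bool → Prog (3 + m) (⊤ ⊎ ⊤)
  joinOdd a nothing  = ret (inj₂ tt)
  joinOdd a (just b) = push #T b >> push #T a >> ret (inj₁ tt)

  joinEven : Fin m → Maybe Bool → Prog (3 + m) (⊤ ⊎ ⊤)
  joinEven k nothing  = ret (inj₂ tt)
  joinEven k (just a) = pop (reg k) >>= joinOdd a

  join : Fin m → Fin m → Prog (3 + m) ⊤
  join j k = iter (λ _ → pop (reg j) >>= joinEven k) tt

  unpair : Fin m → Fin m → Fin m → Prog (3 + m) ⊤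
  unpair i j k = transfer (reg i) #T >> split j k

  module _ {j k : Fin m} (j≢k : j ≢ k) {l r : Str} {ρ : Store m} where

    private
      regs-≢ : _≢_ {A = Fin (3 + m)} (reg j) (reg k)
      regs-≢ refl = j≢k refl

    exec-split : ∀ t u v → Exec (split j k) (l ∷ r ∷ t ∷ (ρ [ j ]≔ u) [ k ]≔ v) tt
      (l ∷ r ∷ [] ∷ (ρ [ j ]≔ (evens t ʳ++ u)) [ k ]≔ (odds t ʳ++ v)) (5 * suc (length t))
    exec-split [] u v = exec-weaken (m≤m+n 2 3) (exec-leave (exec-pop then exec-ret))
    exec-split (a ∷ []) u v = exec-weaken (m≤m+n 3 7) (exec-leave (exec-pop then exec-pop then exec-ret))
    exec-split (a ∷ b ∷ t) u v = exec-weaken (≤-trans (m≤n+m _ 5) (≤-reflexive (sym (arith (length t)))))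
      (exec-again (exec-pop then exec-pop then exec-push-under regs-≢ {l ∷ r ∷ t ∷ ρ} then
                   exec-push-at (l ∷ r ∷ t ∷ ρ [ j ]≔ (a ∷ u)) v then exec-ret)
         (exec-split t (a ∷ u) (b ∷ v)))
      where
      arith : ∀ n → 5 * suc (suc (suc n)) ≡ 5 + (5 + 5 * suc n)
      arith = solve-∀

    exec-join : ∀ t u v → length u ≡ length v → Exec (join j k) (l ∷ r ∷ t ∷ (ρ [ j ]≔ u) [ k ]≔ v) tt
      (l ∷ r ∷ zipUp u v t ∷ (ρ [ j ]≔ []) [ k ]≔ []) (5 * suc (length u))
    exec-join t [] [] _ = exec-weaken (m≤m+n 2 3)
      (exec-leave (exec-pop-under regs-≢ {l ∷ r ∷ t ∷ ρ} [] [] then exec-ret))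
    exec-join t (a ∷ u) (b ∷ v) eq = exec-weaken (≤-reflexive (sym (*-suc 5 (suc (length u)))))
      (exec-again (exec-pop-under regs-≢ {l ∷ r ∷ t ∷ ρ} (a ∷ u) (b ∷ v) then
                   exec-pop-at (l ∷ r ∷ t ∷ ρ [ j ]≔ u) (b ∷ v) then exec-push then exec-push then exec-ret)
         (exec-join (a ∷ b ∷ t) u v (suc-injective eq)))

-- Polynomial bounds

eval-mono : ∀ p {m n} → m ≤ n → eval p m ≤ eval p n
eval-mono [] m≤n      = z≤n
eval-mono (c ∷ p) m≤n = +-monoʳ-≤ c (*-mono-≤ m≤n (eval-mono p m≤n))

infixl 6 _⊕_
infixl 7 _⊗_ _⊙_

_⊕_ : Poly → Poly → Poly
[] ⊕ q            = q
p ⊕ []            = p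
(a ∷ p) ⊕ (b ∷ q) = a + b ∷ p ⊕ q

_⊙_ : ℕ → Poly → Poly
c ⊙ q = map (c *_) q

_⊗_ : Poly → Poly → Poly
[] ⊗ q      = []
(a ∷ p) ⊗ q = a ⊙ q ⊕ (0 ∷ p ⊗ q)

compose : Poly → Poly → Poly
compose [] q      = []
compose (a ∷ p) q = (a ∷ []) ⊕ q ⊗ compose p q

eval-⊕ : ∀ p q n → eval (p ⊕ q) n ≡ eval p n + eval q n
eval-⊕ [] q n            = refl
eval-⊕ (a ∷ p) [] n      = sym (+-identityʳ _)
eval-⊕ (a ∷ p) (b ∷ q) n rewrite eval-⊕ p q n = arith a b n (eval p n) (eval q n)
  where
  arith : ∀ a b n u v → a + b + n * (u + v) ≡ a + n * u + (b + n * v)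
  arith = solve-∀

eval-⊙ : ∀ c q n → eval (c ⊙ q) n ≡ c * eval q n
eval-⊙ c [] n      = sym (*-zeroʳ c)
eval-⊙ c (b ∷ q) n rewrite eval-⊙ c q n = arith c b n (eval q n)
  where
  arith : ∀ c b n v → c * b + n * (c * v) ≡ c * (b + n * v)
  arith = solve-∀

eval-⊗ : ∀ p q n → eval (p ⊗ q) n ≡ eval p n * eval q n
eval-⊗ [] q n      = refl
eval-⊗ (a ∷ p) q n rewrite eval-⊕ (a ⊙ q) (0 ∷ p ⊗ q) n | eval-⊙ a q n | eval-⊗ p q n =
  arith a n (eval p n) (eval q n)
  where
  arith : ∀ a n u v → a * v + n * (u * v) ≡ (a + n * u) * v
  arith = solve-∀

eval-compose : ∀ p q n → eval (compose p q) n ≡ eval p (eval q n)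
eval-compose [] q n      = refl
eval-compose (a ∷ p) q n
  rewrite eval-⊕ (a ∷ []) (q ⊗ compose p q) n | eval-⊗ q (compose p q) n | eval-compose p q n
        | *-zeroʳ n | +-identityʳ a = refl

infixl 6 _⊞_
infixl 7 _⊠_

-- Time bounds are built as expressions that mirror the cost of a run and are turned into
-- coefficient lists only at the end, so `eval-poly` settles all of them at once.
data Expr : Set where
  var : Expr
  con : ℕ → Expr
  app : Poly → Expr → Expr
  _⊞_ : Expr → Expr → Expr
  _⊠_ : Expr → Expr → Expr

value : Expr → ℕ → ℕ
value var n       = n
value (con c) n   = c
value (app p e) n = eval p (value e n)
value (d ⊞ e) n   = value d n + value e n
value (d ⊠ e) n   = value d n * value e n

poly : Expr → Poly
poly var       = 0 ∷ 1 ∷ []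
poly (con c)   = c ∷ []
poly (app p e) = compose p (poly e)
poly (d ⊞ e)   = poly d ⊕ poly e
poly (d ⊠ e)   = poly d ⊗ poly e

eval-poly : ∀ e n → eval (poly e) n ≡ value e n
eval-poly var n rewrite *-zeroʳ n = *-identityʳ n
eval-poly (con c) n rewrite *-zeroʳ n = +-identityʳ c
eval-poly (app p e) n rewrite eval-compose p (poly e) n | eval-poly e n = refl
eval-poly (d ⊞ e) n rewrite eval-⊕ (poly d) (poly e) n | eval-poly d n | eval-poly e n = refl
eval-poly (d ⊠ e) n rewrite eval-⊗ (poly d) (poly e) n | eval-poly d n | eval-poly e n = refl

-- All calls below are charged the same amount, in terms of a common bound V on lengths and running times.

budget : ℕ → ℕ
budget V = 40 * suc (V + V)

module _ {m : ℕ} where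

  work : Store m → Store (3 + m)
  work ρ = [] ∷ [] ∷ [] ∷ ρ

  call-pred : ∀ {ρ : Store m} {M n} i js {w V} → inputTape ρ i js ≡ w → HaltsWithin M n w → length w ≤ V → n ≤ V →
    Exec (callPred M i js) (work ρ) (acceptsIn M n w) (work ρ) (budget V)
  call-pred {ρ} {M} {n} i js refl h w≤V n≤V = exec-weaken
    -- The constant 40 of `budget` is that of `callFun`, the most expensive call.
    (*-mono-≤ (m≤m+n 32 8) (s≤s (+-mono-≤ w≤V n≤V))) (exec-callPred M n i js h)

  call-fun : ∀ {ρ : Store m} {M n} i o {w V} → content ρ i ≡ w → lookup ρ o ≡ [] → HaltsWithin M n (enc w) →
    length w ≤ V → n ≤ V →
    Exec (callFun M i o) (work ρ) tt (work (ρ [ o ]≔ reverse (outputIn M n (enc w)))) (budget V)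
  call-fun {ρ} {M} {n} i o refl empty h w≤V n≤V = exec-weaken
    (*-monoʳ-≤ 40 (s≤s (+-mono-≤ w≤V n≤V))) (exec-callFun M n i o empty h)

  call-equal : ∀ {ρ : Store m} i j {s t V} → content ρ i ≡ s → content ρ j ≡ t → length s ≤ V → length t ≤ V →
    Exec (equal i j) (work ρ) (same? true t (enc s)) (work ρ) (budget V)
  call-equal i j refl refl s≤V t≤V = exec-weaken
    (*-mono-≤ (m≤m+n 14 26) (s≤s (+-mono-≤ s≤V t≤V))) (exec-equal i j)

  call-unpair : ∀ {ρ : Store m} i j k {w V} → j ≢ k → lookup ρ i ≡ reverse w →
    lookup (ρ [ i ]≔ []) j ≡ [] → lookup (ρ [ i ]≔ []) k ≡ [] → length w ≤ V →
    Exec (unpair i j k) (work ρ) tt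
      (work (((ρ [ i ]≔ []) [ j ]≔ reverse (evens w)) [ k ]≔ reverse (odds w))) (budget V)
  call-unpair {ρ} i j k {w} {V} j≢k ρi ρj ρk w≤V = exec-weaken time
    (subst₂ (λ u v → Exec (transfer (reg i) #T) (work u) tt ([] ∷ [] ∷ v ∷ ρ [ i ]≔ []) (3 * length (reverse w) + 2))
       (trans (cong (ρ [ i ]≔_) (sym ρi)) ([]≔-lookup ρ i)) (reverse-involutive w) (drain {ρ = ρ} (reverse w) []) then
     subst (λ u → Exec (split j k) ([] ∷ [] ∷ w ∷ u) tt
                    (work (((ρ [ i ]≔ []) [ j ]≔ reverse (evens w)) [ k ]≔ reverse (odds w))) (5 * suc (length w)))
       emptied (exec-split j≢k w [] []))
    where
    emptied : ((ρ [ i ]≔ []) [ j ]≔ []) [ k ]≔ [] ≡ ρ [ i ]≔ []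
    emptied = trans (cong (_[ k ]≔ []) (trans (cong ((ρ [ i ]≔ []) [ j ]≔_) (sym ρj)) ([]≔-lookup (ρ [ i ]≔ []) j)))
      (trans (cong ((ρ [ i ]≔ []) [ k ]≔_) (sym ρk)) ([]≔-lookup (ρ [ i ]≔ []) k))
    arith : ∀ n → 3 * n + 2 + 5 * suc n + (32 * n + 33) ≡ 40 * suc n
    arith = solve-∀
    time : 3 * length (reverse w) + 2 + 5 * suc (length w) ≤ budget V
    time rewrite length-reverse w = ≤-trans (m≤m+n _ _) (≤-trans (≤-reflexive (arith (length w)))
      (*-monoʳ-≤ 40 (s≤s (≤-trans w≤V (m≤m+n V V)))))

-- Registers and the layout of inputs

y₁ z₁ y₂ z₂ bot top w₂ w₁ x₀ : Fin 9
y₁  = # 0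
z₁  = # 1
y₂  = # 2
z₂  = # 3
bot = # 4
top = # 5
w₂  = # 6
w₁  = # 7
x₀  = # 8

-- An input of k strings already contains k - 1 separators and fills the last k stacks, so the compiled
-- machine appends the other 13 - k ones. A missing string is an empty stack.
initial : Str → Str → Str → Store 9
initial x w w' = [] ∷ [] ∷ [] ∷ [] ∷ [] ∷ [] ∷ reverse w' ∷ reverse w ∷ reverse x ∷ []

reverse-enc : ∀ x → reverse (enc x) ≡ enc (reverse x) ++ []
reverse-enc x = enc-reverse-ʳ++ x

enc-sep-ʳ++ : ∀ x r {acc} → (enc x ++ sep ∷ r) ʳ++ acc ≡ r ʳ++ (sep ∷ enc (reverse x) ++ acc)
enc-sep-ʳ++ x r {acc} = trans (++-ʳ++ (enc x)) (cong (λ u → r ʳ++ (sep ∷ u)) (enc-reverse-ʳ++ x))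

layout₁ : ∀ x → replicate 12 sep ++ reverse (enc x) ≡ lay (work (initial x [] []))
layout₁ x = cong (replicate 12 sep ++_) (reverse-enc x)

layout₂ : ∀ x w → replicate 11 sep ++ reverse (enc2 x w) ≡ lay (work (initial x w []))
layout₂ x w = cong (replicate 11 sep ++_) (trans (enc-sep-ʳ++ x (enc w)) (enc-reverse-ʳ++ w))

layout₃ : ∀ x w w' → replicate 10 sep ++ reverse (enc3 x w w') ≡ lay (work (initial x w w'))
layout₃ x w w' = cong (replicate 10 sep ++_)
  (trans (enc-sep-ʳ++ x (enc w ++ sep ∷ enc w')) (trans (enc-sep-ʳ++ w (enc w')) (enc-reverse-ʳ++ w')))

enc2-marks : ∀ x w → Marks (enc2 x w)
enc2-marks x w = All.++⁺ (enc-marks x) ((λ ()) ∷ enc-marks w)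

length-enc2 : ∀ x w → length (enc2 x w) ≡ suc (length x + length w)
length-enc2 x w = trans (length-++ (enc x)) (trans (+-suc _ _) (cong suc (cong₂ _+_ (length-enc x) (length-enc w))))

length-enc3 : ∀ x y z → length (enc3 x y z) ≡ 2 + (length x + length y + length z)
length-enc3 x y z = trans (length-++ (enc x)) (trans (+-suc _ _) (cong suc (trans (cong₂ _+_ (length-enc x) (length-enc2 y z))
  (trans (+-suc (length x) _) (cong suc (sym (+-assoc (length x) (length y) (length z))))))))

timeE : ℕ → Expr → Expr → Expr
timeE e c m = (con 1 ⊞ m) ⊞ (con (suc e) ⊞ (c ⊠ (con 4 ⊠ (con e ⊞ m ⊞ c) ⊞ con 5) ⊞ (con 3 ⊞ (con e ⊞ m ⊞ c))))

budgetE : Expr → Expr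
budgetE V = con 40 ⊠ (con 1 ⊞ (V ⊞ V))

timeE-correct : ∀ e c m n → eval (poly (timeE e c m)) n ≡ compile-time e (value c n) (value m n)
timeE-correct e c m n = eval-poly (timeE e c m) n

length-evens : ∀ w → length (evens w) ≤ length w
length-evens []          = z≤n
length-evens (_ ∷ [])    = z≤n
length-evens (_ ∷ _ ∷ w) = s≤s (≤-trans (length-evens w) (n≤1+n _))

length-odds : ∀ w → length (odds w) ≡ length (evens w)
length-odds []          = refl
length-odds (_ ∷ [])    = refl
length-odds (_ ∷ _ ∷ w) = cong suc (length-odds w)

length-evens-double : ∀ n w → length w ≡ n + n → length (evens w) ≡ n
length-evens-double zero [] eq = refl
length-evens-double (suc n) [] ()
length-evens-double (suc n) (_ ∷ []) eq = contradiction (trans (suc-injective eq) (+-suc n n)) λ ()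
length-evens-double (suc n) (_ ∷ _ ∷ w) eq =
  cong suc (length-evens-double n w (suc-injective (trans (suc-injective eq) (+-suc n n))))

holds3? : PolyPred3 → Str → Str → Str → Bool
holds3? P x y z = acceptsIn (PolyPred3.machine P)
  (eval (PolyPred3.bound P) (length x + length y + length z)) (enc3 x y z)

-- The machine that accepts chained pairs

module _ (p : Poly) (M : BalancedNPTM p) (P : PolyPred3) where
  private
    module M = BalancedNPTM M
    module P = PolyPred3 P

  acceptProg : Prog 12 Bool
  acceptProg = unpair w₁ y₁ z₁ >> callPred M.machine x₀ (y₁ ∷ []) >>= λ u →
    callPred M.machine x₀ (z₁ ∷ []) >>= λ v → callPred P.machine x₀ (y₁ ∷ z₁ ∷ []) >>= λ s → ret (u ∧ (v ∧ s))

  private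
    boundE lengthE costE : Expr
    lengthE = app p var
    -- The 2 covers the separators of `enc3`. In `costE` each call costs one budget and the final
    -- `ret` costs 1, nested to the right like the chain of `then` that it has to match.
    boundE = con 2 ⊞ (var ⊞ (lengthE ⊞ lengthE)) ⊞ (app M.bound var ⊞ app P.bound (var ⊞ lengthE ⊞ lengthE))
    costE  = budgetE boundE ⊞ (budgetE boundE ⊞ (budgetE boundE ⊞ (budgetE boundE ⊞ con 1)))

    tapeE : Expr
    tapeE = con 1 ⊞ (var ⊞ (lengthE ⊞ lengthE))

  pairMachine : TM
  pairMachine = compile 11 acceptProg

  pairBound : Poly
  pairBound = poly (timeE 11 costE tapeE)

  private
    module Run (x w : Str) (w-length : length w ≡ eval (p ⊕ p) (length x)) where
      n : ℕ
      n = eval p (length x)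
      V : ℕ
      V = value boundE (length x)
      y z : Str
      y = evens w
      z = odds w
      w-length' : length w ≡ n + n
      w-length' = trans w-length (eval-⊕ p p (length x))
      y-length : length y ≡ n
      y-length = length-evens-double n w w-length'
      z-length : length z ≡ n
      z-length = trans (length-odds w) y-length
      base≤V : 2 + (length x + (n + n)) ≤ V
      base≤V = m≤m+n _ _
      w≤V : length w ≤ V
      w≤V = ≤-trans (≤-reflexive w-length') (≤-trans (≤-trans (m≤n+m (n + n) (length x)) (m≤n+m _ 2)) base≤V)
      enc2≤V : ∀ v → length v ≡ n → length (enc2 x v) ≤ V
      enc2≤V v eq rewrite length-enc2 x v | eq =
        ≤-trans (s≤s (≤-trans (+-monoʳ-≤ (length x) (m≤m+n n n)) (n≤1+n _))) base≤V
      enc3≤V : length (enc3 x y z) ≤ V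
      enc3≤V rewrite length-enc3 x y z | y-length | z-length =
        ≤-trans (≤-reflexive (cong (2 +_) (+-assoc (length x) n n))) base≤V
      M≤V : eval M.bound (length x) ≤ V
      M≤V = ≤-trans (m≤m+n _ _) (m≤n+m _ (2 + (length x + (n + n))))
      P≤V : eval P.bound (length x + length y + length z) ≤ V
      P≤V rewrite y-length | z-length = ≤-trans (m≤n+m _ (eval M.bound (length x))) (m≤n+m _ (2 + (length x + (n + n))))

      run-accept : Exec acceptProg (work (initial x w []))
        (accPath M x y ∧ (accPath M x z ∧ holds3? P x y z))
        (work ((((initial x w []) [ w₁ ]≔ []) [ y₁ ]≔ reverse y) [ z₁ ]≔ reverse z)) (value costE (length x))
      run-accept = call-unpair w₁ y₁ z₁ {w} (λ ()) refl refl refl w≤V then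
        call-pred x₀ (y₁ ∷ []) (cong₂ enc2 (reverse-involutive x) (reverse-involutive y)) (M.total x y y-length) (enc2≤V y y-length) M≤V then
        call-pred x₀ (z₁ ∷ []) (cong₂ enc2 (reverse-involutive x) (reverse-involutive z)) (M.total x z z-length) (enc2≤V z z-length) M≤V then
        call-pred x₀ (y₁ ∷ z₁ ∷ []) (cong₂ (λ u v → u v) (cong₂ enc3 (reverse-involutive x) (reverse-involutive y)) (reverse-involutive z))
          (P.total x y z) enc3≤V P≤V then exec-ret

      correct : HaltsWithin pairMachine (eval pairBound (length x)) (enc2 x w) ×
        acceptsIn pairMachine (eval pairBound (length x)) (enc2 x w) ≡
          accPath M x y ∧ (accPath M x z ∧ holds3? P x y z) ×
        outputIn pairMachine (eval pairBound (length x)) (enc2 x w) ≡ []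
      correct = compile-correct 11 acceptProg run-accept (enc2-marks x w) (layout₂ x w)
        (≤-reflexive (trans (cong (compile-time 11 (value costE (length x))) (trans (length-enc2 x w) (cong (λ k → suc (length x + k)) w-length')))
          (sym (timeE-correct 11 costE tapeE (length x)))))

  pairNPTM : BalancedNPTM (p ⊕ p)
  pairNPTM = record
    { machine = pairMachine
    ; bound   = pairBound
    ; total   = λ x w eq → proj₁ (Run.correct x w eq)
    }

  accPath-pair : ∀ x w → length w ≡ eval (p ⊕ p) (length x) →
    accPath pairNPTM x w ≡ accPath M x (evens w) ∧ (accPath M x (odds w) ∧ holds3? P x (evens w) (odds w))
  accPath-pair x w eq = proj₁ (proj₂ (Run.correct x w eq))

length-interleave : ∀ y z → length y ≡ length z → length (interleave y z) ≡ length y + length y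
length-interleave [] [] _           = refl
length-interleave (a ∷ y) (b ∷ z) eq =
  cong suc (trans (cong suc (length-interleave y z (suc-injective eq))) (sym (+-suc (length y) (length y))))

-- Computing the bottom and the top pair

module _ {f g : Str → Str} (F : FPt f) (G : FPt g) (p : Poly)
         (f-length : ∀ x → length (f x) ≡ eval p (length x)) (g-length : ∀ x → length (g x) ≡ eval p (length x)) where

  private
    MF MG : TM
    MF = proj₁ F
    MG = proj₁ G
    qF qG : Poly
    qF = proj₁ (proj₂ F)
    qG = proj₁ (proj₂ G)

  joinProg : Prog 12 Bool
  -- The output is the reversal of stack 0, which is `#L`; moving the interleaving there from `#T`
  -- reverses it too, and the two reversals cancel.
  joinProg = callFun MF x₀ top >> callFun MG x₀ bot >> join top bot >> transfer #T #L >> ret true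

  private
    boundE costE : Expr
    boundE = var ⊞ (app p var ⊞ (app qF var ⊞ app qG var))
    costE  = budgetE boundE ⊞ (budgetE boundE ⊞ (budgetE boundE ⊞ (budgetE boundE ⊞ con 1)))

    joinMachine : TM
    joinMachine = compile 12 joinProg

    joinBound : Poly
    joinBound = poly (timeE 12 costE var)

    module Run (x : Str) where
      V : ℕ
      V = value boundE (length x)
      fx gx w : Str
      fx = f x
      gx = g x
      w  = interleave fx gx
      fg : length fx ≡ length gx
      fg = trans (f-length x) (sym (g-length x))
      f≤V : length fx ≤ V
      f≤V = ≤-trans (≤-reflexive (f-length x)) (≤-trans (m≤m+n _ _) (m≤n+m _ (length x)))
      F≤V : eval qF (length x) ≤ V
      F≤V = ≤-trans (m≤m+n _ _) (≤-trans (m≤n+m _ (eval p (length x))) (m≤n+m _ (length x)))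
      G≤V : eval qG (length x) ≤ V
      G≤V = ≤-trans (m≤n+m _ (eval qF (length x))) (≤-trans (m≤n+m _ (eval p (length x))) (m≤n+m _ (length x)))

      ρ₁ ρ₂ ρ₃ : Store 9
      ρ₁ = initial x [] [] [ top ]≔ reverse fx
      ρ₂ = ρ₁ [ bot ]≔ reverse gx
      ρ₃ = (initial x [] [] [ top ]≔ []) [ bot ]≔ []

      run-f : Exec (callFun MF x₀ top) (work (initial x [] [])) tt (work ρ₁) (budget V)
      run-f = subst (λ u → Exec (callFun MF x₀ top) (work (initial x [] [])) tt (work (initial x [] [] [ top ]≔ reverse u)) (budget V))
        (proj₂ (proj₂ (proj₂ F) x))
        (call-fun {n = eval qF (length x)} x₀ top {V = V} (reverse-involutive x) refl (proj₁ (proj₂ (proj₂ F) x)) (m≤m+n _ _) F≤V)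

      run-g : Exec (callFun MG x₀ bot) (work ρ₁) tt (work ρ₂) (budget V)
      run-g = subst (λ u → Exec (callFun MG x₀ bot) (work ρ₁) tt (work (ρ₁ [ bot ]≔ reverse u)) (budget V))
        (proj₂ (proj₂ (proj₂ G) x))
        (call-fun {n = eval qG (length x)} x₀ bot {V = V} (reverse-involutive x) refl (proj₁ (proj₂ (proj₂ G) x)) (m≤m+n _ _) G≤V)

      run-join : Exec (join top bot) (work ρ₂) tt ([] ∷ [] ∷ w ∷ ρ₃) (budget V)
      run-join = subst (λ u → Exec (join top bot) (work ρ₂) tt ([] ∷ [] ∷ u ∷ ρ₃) (budget V))
        (trans (zipUp-reverse fx gx [] fg) (++-identityʳ w))
        (exec-weaken (*-mono-≤ (m≤m+n 5 35) (s≤s (≤-trans (≤-reflexive (length-reverse fx)) (≤-trans f≤V (m≤m+n V V)))))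
          (exec-join {j = top} {bot} (λ ()) {ρ = initial x [] []} [] (reverse fx) (reverse gx)
            (trans (length-reverse fx) (trans fg (sym (length-reverse gx))))))

      move-time : 3 * length w + 2 ≤ budget V
      move-time rewrite length-interleave fx gx fg = ≤-trans (m≤m+n _ _) (≤-trans (≤-reflexive (arith (length fx)))
        (*-monoʳ-≤ 40 (s≤s (+-mono-≤ f≤V f≤V))))
        where
        arith : ∀ n → 3 * (n + n) + 2 + (37 * (n + n) + 38) ≡ 40 * suc (n + n)
        arith = solve-∀

      run-all : Exec joinProg (work (initial x [] [])) true (reverse w ∷ [] ∷ [] ∷ ρ₃) (value costE (length x))
      run-all = run-f then run-g then run-join then
        exec-weaken move-time (exec-transfer {i = #T} {#L} (λ ()) {[] ∷ [] ∷ [] ∷ ρ₃} w []) then exec-ret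

      correct : HaltsWithin joinMachine (eval joinBound (length x)) (enc x) ×
        acceptsIn joinMachine (eval joinBound (length x)) (enc x) ≡ true ×
        outputIn joinMachine (eval joinBound (length x)) (enc x) ≡ reverse (reverse w)
      correct = compile-correct 12 joinProg run-all (enc-marks x) (layout₁ x)
        (≤-reflexive (trans (cong (compile-time 12 (value costE (length x))) (length-enc x))
          (sym (timeE-correct 12 costE var (length x)))))

  FPt-interleave : FPt (λ x → interleave (f x) (g x))
  FPt-interleave = joinMachine , joinBound , λ x →
    proj₁ (Run.correct x) , trans (proj₂ (proj₂ (Run.correct x))) (reverse-involutive _)

-- Deciding adjacency of pairs

sameStr : Str → Str → Bool
sameStr s t = same? true t (enc s)

-- The first disjunct stays inside a block, where only the first component may wrap round. The
-- second one enters the next block, and its negated test excludes the very last pair, which has no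
-- successor.
pairPrec? : PolyPred3 → (b t : Str → Str) → Str → Str → Str → Bool
pairPrec? P b t x w w' =
  (holds3? P x (odds w) (odds w') ∧
    (holds3? P x (evens w) (evens w') ∨ (sameStr (evens w) (t x) ∧ sameStr (evens w') (b x)))) ∨
  ((sameStr (odds w) (t x) ∧ sameStr (odds w') (b x)) ∧
    (sameStr (evens w) (evens w') ∧ not (sameStr (evens w) (t x))))

module _ (P : PolyPred3) {b t : Str → Str} (B : FPt b) (T : FPt t) (p : Poly)
         (b-length : ∀ x → length (b x) ≡ eval p (length x)) (t-length : ∀ x → length (t x) ≡ eval p (length x)) where

  private
    module P = PolyPred3 P
    MB MT : TM
    MB = proj₁ B
    MT = proj₁ T
    qB qT : Poly
    qB = proj₁ (proj₂ B)
    qT = proj₁ (proj₂ T)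

  precProg : Prog 12 Bool
  precProg =
    unpair w₁ y₁ z₁ >> unpair w₂ y₂ z₂ >> callFun MT x₀ top >> callFun MB x₀ bot >>
    callPred P.machine x₀ (z₁ ∷ z₂ ∷ []) >>= λ z≺z' → callPred P.machine x₀ (y₁ ∷ y₂ ∷ []) >>= λ y≺y' →
    equal y₁ top >>= λ y=t → equal y₂ bot >>= λ y'=b → equal z₁ top >>= λ z=t → equal z₂ bot >>= λ z'=b →
    equal y₁ y₂ >>= λ y=y' → ret ((z≺z' ∧ (y≺y' ∨ (y=t ∧ y'=b))) ∨ ((z=t ∧ z'=b) ∧ (y=y' ∧ not y=t)))

  private
    boundE costE tapeE : Expr
    boundE = con 2 ⊞ var ⊞ (app P.bound var ⊞ (app p var ⊞ (app qB var ⊞ app qT var)))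
    costE  = B' ⊞ (B' ⊞ (B' ⊞ (B' ⊞ (B' ⊞ (B' ⊞ (B' ⊞ (B' ⊞ (B' ⊞ (B' ⊞ (B' ⊞ con 1))))))))))
      where
      B' : Expr
      B' = budgetE boundE
    tapeE = con 2 ⊞ var

    precMachine : TM
    precMachine = compile 10 precProg

    precBound : Poly
    precBound = poly (timeE 10 costE tapeE)

    module Run (x w w' : Str) where
      -- A `PolyPred3` must halt on strings of all lengths, so the bounds are in terms of the total
      -- input length and cannot rely on `w` and `w'` being paths.
      N V : ℕ
      N = length x + length w + length w'
      V = value boundE N

      rest : ℕ
      rest = eval P.bound N + (eval p N + (eval qB N + eval qT N))

      2+N≤V : 2 + N ≤ V
      2+N≤V = m≤m+n (2 + N) rest
      N≤V : N ≤ V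
      N≤V = ≤-trans (m≤n+m N 2) 2+N≤V
      rest≤V : rest ≤ V
      rest≤V = m≤n+m rest (2 + N)
      x≤N : length x ≤ N
      x≤N = ≤-trans (m≤m+n _ _) (m≤m+n _ _)
      w≤N : length w ≤ N
      w≤N = ≤-trans (m≤n+m _ (length x)) (m≤m+n _ _)
      w'≤N : length w' ≤ N
      w'≤N = m≤n+m _ (length x + length w)

      p≤V : ∀ {n} → n ≡ eval p (length x) → n ≤ V
      p≤V eq = ≤-trans (≤-reflexive eq) (≤-trans (eval-mono p x≤N)
        (≤-trans (≤-trans (m≤m+n _ _) (m≤n+m _ (eval P.bound N))) rest≤V))
      B≤V : eval qB (length x) ≤ V
      B≤V = ≤-trans (eval-mono qB x≤N) (≤-trans (≤-trans (≤-trans (m≤m+n _ _) (m≤n+m _ (eval p N))) (m≤n+m _ (eval P.bound N))) rest≤V)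
      T≤V : eval qT (length x) ≤ V
      T≤V = ≤-trans (eval-mono qT x≤N) (≤-trans (≤-trans (≤-trans (m≤n+m _ (eval qB N)) (m≤n+m _ (eval p N))) (m≤n+m _ (eval P.bound N))) rest≤V)

      e≤ : ∀ v {k} → length v ≤ k → length (evens v) ≤ k
      e≤ v = ≤-trans (length-evens v)
      o≤ : ∀ v {k} → length v ≤ k → length (odds v) ≤ k
      o≤ v h = ≤-trans (≤-reflexive (length-odds v)) (e≤ v h)

      ρ₀ ρ₁ ρ₂ ρ₃ ρ₄ : Store 9
      ρ₀ = initial x w w'
      ρ₁ = ((ρ₀ [ w₁ ]≔ []) [ y₁ ]≔ reverse (evens w)) [ z₁ ]≔ reverse (odds w)
      ρ₂ = ((ρ₁ [ w₂ ]≔ []) [ y₂ ]≔ reverse (evens w')) [ z₂ ]≔ reverse (odds w')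
      ρ₃ = ρ₂ [ top ]≔ reverse (t x)
      ρ₄ = ρ₃ [ bot ]≔ reverse (b x)

      run-t : Exec (callFun MT x₀ top) (work ρ₂) tt (work ρ₃) (budget V)
      run-t = subst (λ u → Exec (callFun MT x₀ top) (work ρ₂) tt (work (ρ₂ [ top ]≔ reverse u)) (budget V))
        (proj₂ (proj₂ (proj₂ T) x))
        (call-fun {n = eval qT (length x)} x₀ top {V = V} (reverse-involutive x) refl (proj₁ (proj₂ (proj₂ T) x)) (≤-trans x≤N N≤V) T≤V)

      run-b : Exec (callFun MB x₀ bot) (work ρ₃) tt (work ρ₄) (budget V)
      run-b = subst (λ u → Exec (callFun MB x₀ bot) (work ρ₃) tt (work (ρ₃ [ bot ]≔ reverse u)) (budget V))
        (proj₂ (proj₂ (proj₂ B) x))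
        (call-fun {n = eval qB (length x)} x₀ bot {V = V} (reverse-involutive x) refl (proj₁ (proj₂ (proj₂ B) x)) (≤-trans x≤N N≤V) B≤V)

      run-prec : ∀ i j {u v} → content ρ₄ i ≡ u → content ρ₄ j ≡ v → length u ≤ length w → length v ≤ length w' →
        Exec (callPred P.machine x₀ (i ∷ j ∷ [])) (work ρ₄) (holds3? P x u v) (work ρ₄) (budget V)
      run-prec i j {u} {v} refl refl u≤ v≤ =
        call-pred x₀ (i ∷ j ∷ []) (cong (λ x → enc3 x u v) (reverse-involutive x)) (P.total x u v)
          (≤-trans (≤-reflexive (length-enc3 x u v)) (≤-trans (+-monoʳ-≤ 2 sum≤) 2+N≤V))
          (≤-trans (eval-mono P.bound sum≤) (≤-trans (m≤m+n _ _) rest≤V))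
        where
        sum≤ : length x + length u + length v ≤ N
        sum≤ = +-mono-≤ (+-monoʳ-≤ (length x) u≤) v≤

      run-all : Exec precProg (work ρ₀) (pairPrec? P b t x w w') (work ρ₄) (value costE N)
      run-all =
        call-unpair w₁ y₁ z₁ {w} (λ ()) refl refl refl (≤-trans w≤N N≤V) then
        call-unpair w₂ y₂ z₂ {w'} (λ ()) refl refl refl (≤-trans w'≤N N≤V) then
        run-t then run-b then
        run-prec z₁ z₂ (reverse-involutive (odds w)) (reverse-involutive (odds w')) (o≤ w ≤-refl) (o≤ w' ≤-refl) then
        run-prec y₁ y₂ (reverse-involutive (evens w)) (reverse-involutive (evens w')) (e≤ w ≤-refl) (e≤ w' ≤-refl) then
        call-equal y₁ top (reverse-involutive (evens w)) (reverse-involutive (t x)) (e≤ w (≤-trans w≤N N≤V)) (p≤V (t-length x)) then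
        call-equal y₂ bot (reverse-involutive (evens w')) (reverse-involutive (b x)) (e≤ w' (≤-trans w'≤N N≤V)) (p≤V (b-length x)) then
        call-equal z₁ top (reverse-involutive (odds w)) (reverse-involutive (t x)) (o≤ w (≤-trans w≤N N≤V)) (p≤V (t-length x)) then
        call-equal z₂ bot (reverse-involutive (odds w')) (reverse-involutive (b x)) (o≤ w' (≤-trans w'≤N N≤V)) (p≤V (b-length x)) then
        call-equal y₁ y₂ (reverse-involutive (evens w)) (reverse-involutive (evens w')) (e≤ w (≤-trans w≤N N≤V)) (e≤ w' (≤-trans w'≤N N≤V)) then
        exec-ret

      correct : HaltsWithin precMachine (eval precBound N) (enc3 x w w') ×
        acceptsIn precMachine (eval precBound N) (enc3 x w w') ≡ pairPrec? P b t x w w' ×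
        outputIn precMachine (eval precBound N) (enc3 x w w') ≡ []
      correct = compile-correct 10 precProg run-all (All.++⁺ (enc-marks x) ((λ ()) ∷ enc2-marks w w')) (layout₃ x w w')
        (≤-reflexive (trans (cong (compile-time 10 (value costE N)) (length-enc3 x w w'))
          (sym (timeE-correct 10 costE tapeE N))))

  pairPrec : PolyPred3
  pairPrec = record
    { machine = precMachine
    ; bound   = precBound
    ; total   = λ x w w' → proj₁ (Run.correct x w w')
    }

  holds3-pair : ∀ x w w' → holds3? pairPrec x w w' ≡ pairPrec? P b t x w w'
  holds3-pair x w w' = proj₁ (proj₂ (Run.correct x w w'))

-- Lexicographic order and binary values

digit : Bool → ℕ
digit false = 0
digit true  = 1

val : Str → ℕ
val []      = 0
val (b ∷ s) = digit b * 2 ^ length s + val s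

val<2^ : ∀ s → val s < 2 ^ length s
val<2^ []          = s≤s z≤n
val<2^ (false ∷ s) = ≤-trans (val<2^ s) (m≤m+n _ _)
val<2^ (true ∷ s) rewrite +-identityʳ (2 ^ length s) = +-monoʳ-< (2 ^ length s) (val<2^ s)

≤lex⇒val≤ : ∀ {a b} → length a ≡ length b → a ≤lex b → val a ≤ val b
≤lex⇒val≤ eq []≤ = z≤n
≤lex⇒val≤ eq (0<1 {a} {b}) =
  ≤-trans (<⇒≤ (subst (λ n → val a < 2 ^ n) (suc-injective eq) (val<2^ a))) (≤-trans (m≤m+n _ 0) (m≤m+n _ (val b)))
≤lex⇒val≤ eq (same {c} {a} {b} a≤b) rewrite suc-injective eq =
  +-monoʳ-≤ (digit c * 2 ^ length b) (≤lex⇒val≤ (suc-injective eq) a≤b)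

val≤⇒≤lex : ∀ {a b} → length a ≡ length b → val a ≤ val b → a ≤lex b
val≤⇒≤lex {[]} eq h = []≤
val≤⇒≤lex {false ∷ a} {false ∷ b} eq h = same (val≤⇒≤lex (suc-injective eq) h)
val≤⇒≤lex {false ∷ a} {true ∷ b} eq h  = 0<1
val≤⇒≤lex {true ∷ a} {false ∷ b} eq h rewrite suc-injective eq | +-identityʳ (2 ^ length b) =
  contradiction (≤-<-trans (≤-trans (m≤m+n _ _) h) (val<2^ b)) (<-irrefl refl)
val≤⇒≤lex {true ∷ a} {true ∷ b} eq h rewrite suc-injective eq =
  same (val≤⇒≤lex (suc-injective eq) (+-cancelˡ-≤ (1 * 2 ^ length b) _ _ h))

≤lex-antisym : ∀ {a b} → length a ≡ length b → a ≤lex b → b ≤lex a → a ≡ b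
≤lex-antisym {b = []} eq []≤ []≤      = refl
≤lex-antisym eq (same {c} p) (same q) = cong (c ∷_) (≤lex-antisym (suc-injective eq) p q)

val-injective : ∀ {a b} → length a ≡ length b → val a ≡ val b → a ≡ b
val-injective eq h = ≤lex-antisym eq (val≤⇒≤lex eq (≤-reflexive h)) (val≤⇒≤lex (sym eq) (≤-reflexive (sym h)))

toBits : ℕ → ℕ → Str
toBits zero k = []
toBits (suc n) k with k <? 2 ^ n
... | yes _ = false ∷ toBits n k
... | no _  = true ∷ toBits n (k ∸ 2 ^ n)

length-toBits : ∀ n k → length (toBits n k) ≡ n
length-toBits zero k = refl
length-toBits (suc n) k with k <? 2 ^ n
... | yes _ = cong suc (length-toBits n k)
... | no _  = cong suc (length-toBits n _)

val-toBits : ∀ n {k} → k < 2 ^ n → val (toBits n k) ≡ k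
val-toBits zero (s≤s z≤n) = refl
val-toBits (suc n) {k} k< with k <? 2 ^ n
... | yes k<2^n = val-toBits n k<2^n
... | no k≮2^n rewrite length-toBits n (k ∸ 2 ^ n) | +-identityʳ (2 ^ n) =
  trans (cong (2 ^ n +_) (val-toBits n (+-cancelˡ-< (2 ^ n) _ _ (subst (_< 2 ^ n + 2 ^ n) (sym eq) k<)))) eq
  where
  eq : 2 ^ n + (k ∸ 2 ^ n) ≡ k
  eq = m+[n∸m]≡n (≮⇒≥ k≮2^n)

-- For the forward direction, minimality of `b` is tested against the string `c` of value
-- `suc (val a)`. It exists because that value is at most `val b`, hence below `2 ^ length a`.
≺lex⇔suc : ∀ {a b} → length a ≡ length b → (a ≺lex b) ⇔ (suc (val a) ≡ val b)
≺lex⇔suc {a} {b} eq = mk⇔ to from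
  where
  to : a ≺lex b → suc (val a) ≡ val b
  to (_ , (a≤b , a≢b) , least) = ≤-antisym a<b
    (subst (val b ≤_) val-c (≤lex⇒val≤ (trans (sym eq) (sym length-c))
      (least c length-c (val≤⇒≤lex (sym length-c) (≤-trans (n≤1+n _) (≤-reflexive (sym val-c))) ,
        λ a≡c → <-irrefl (trans (cong val a≡c) val-c) ≤-refl))))
    where
    a<b : val a < val b
    a<b = ≤∧≢⇒< (≤lex⇒val≤ eq a≤b) (a≢b ∘ val-injective eq)
    c : Str
    c = toBits (length a) (suc (val a))
    length-c : length c ≡ length a
    length-c = length-toBits (length a) _
    val-c : val c ≡ suc (val a)
    val-c = val-toBits (length a) (subst (λ n → suc (val a) < 2 ^ n) (sym eq) (≤-<-trans a<b (val<2^ b)))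

  from : suc (val a) ≡ val b → a ≺lex b
  from h = eq , (val≤⇒≤lex eq (≤-trans (n≤1+n _) (≤-reflexive h)) , λ a≡b → <-irrefl (cong val a≡b) (≤-reflexive h)) ,
    λ c c-length (a≤c , a≢c) → val≤⇒≤lex (trans (sym eq) (sym c-length))
      (≤-trans (≤-reflexive (sym h)) (≤∧≢⇒< (≤lex⇒val≤ (sym c-length) a≤c) (a≢c ∘ val-injective (sym c-length))))

val-zeros : ∀ n → val (replicate n false) ≡ 0
val-zeros zero    = refl
val-zeros (suc n) = val-zeros n

val-ones : ∀ n → suc (val (replicate n true)) ≡ 2 ^ n
val-ones zero = refl
val-ones (suc n) rewrite length-replicate n {true} | +-identityʳ (2 ^ n) =
  trans (sym (+-suc (2 ^ n) _)) (cong (2 ^ n +_) (val-ones n))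

-- The order on pairs: (a , c) is number D N + c, where D = c - a - 1 modulo N.

Offset : ℕ → ℕ → ℕ → ℕ → Set
Offset N D a c = (D + suc a ≡ c) ⊎ (D + suc a ≡ c + N)

CyclicSuc : ℕ → ℕ → ℕ → Set
CyclicSuc N a a' = suc a ≡ a' ⊎ (suc a ≡ N × a' ≡ 0)

offset : ℕ → ℕ → ℕ → ℕ
offset N a c with a <? c
... | yes _ = c ∸ suc a
... | no _  = c + N ∸ suc a

module _ {N : ℕ} where

  offset-Offset : ∀ {a c} → a < N → c < N → offset N a c < N × Offset N (offset N a c) a c
  offset-Offset {a} {c} a<N c<N with a <? c
  ... | yes a<c = ≤-<-trans (m∸n≤m c (suc a)) c<N , inj₁ (m∸n+n≡m a<c)
  ... | no a≮c  = +-cancelʳ-< (suc a) _ _ (subst (_< N + suc a) (sym eq)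
                    (subst (c + N <_) (+-comm (suc a) N) (+-monoˡ-< N (s≤s (≮⇒≥ a≮c))))) , inj₂ eq
    where
    eq : c + N ∸ suc a + suc a ≡ c + N
    eq = m∸n+n≡m (≤-trans a<N (m≤n+m N c))

  -- The offset and the first rank play interchangeable roles. So whatever determines D from a and c
  -- also determines, or computes, a from D and c.
  Offset-sym : ∀ {D a c} → Offset N D a c → Offset N a D c
  Offset-sym {D} {a} (inj₁ h) = inj₁ (trans (trans (+-suc a D) (trans (cong suc (+-comm a D)) (sym (+-suc D a)))) h)
  Offset-sym {D} {a} (inj₂ h) = inj₂ (trans (trans (+-suc a D) (trans (cong suc (+-comm a D)) (sym (+-suc D a)))) h)

  private
    -- The solutions of the two cases of `Offset` differ by exactly `N`, so they cannot both lie
    -- below `N`.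
    no-wrap : ∀ {D D' a c} → D' < N → D + suc a ≡ c → D' + suc a ≡ c + N → ⊥
    no-wrap {D} {D'} {a} {c} D'<N h h' = <-irrefl refl (≤-<-trans (≤-trans (m≤n+m N D) (≤-reflexive (sym D'≡))) D'<N)
      where
      arith : ∀ D s N → D + s + N ≡ D + N + s
      arith = solve-∀
      D'≡ : D' ≡ D + N
      D'≡ = +-cancelʳ-≡ (suc a) D' (D + N) (trans h' (trans (cong (_+ N) (sym h)) (arith D (suc a) N)))

  Offset-unique : ∀ {D D' a c} → D < N → D' < N → Offset N D a c → Offset N D' a c → D ≡ D'
  Offset-unique {a = a} _ _ (inj₁ h) (inj₁ h') = +-cancelʳ-≡ (suc a) _ _ (trans h (sym h'))
  Offset-unique {a = a} _ _ (inj₂ h) (inj₂ h') = +-cancelʳ-≡ (suc a) _ _ (trans h (sym h'))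
  Offset-unique _ D'<N (inj₁ h) (inj₂ h') = ⊥-elim (no-wrap D'<N h h')
  Offset-unique D<N _ (inj₂ h) (inj₁ h') = ⊥-elim (no-wrap D<N h' h)

  -- A step in both components stays on the diagonal. When a wraps to 0, the second case of `Offset`
  -- turns into the first; the first case cannot occur there, since a = N - 1 would give c ≥ N.
  Offset-suc : ∀ {D a a' c} → c < N → Offset N D a c → CyclicSuc N a a' → Offset N D a' (suc c)
  Offset-suc {D} {a} c<N (inj₁ h) (inj₁ refl) = inj₁ (trans (+-suc D (suc a)) (cong suc h))
  Offset-suc {D} {a} c<N (inj₂ h) (inj₁ refl) = inj₂ (trans (+-suc D (suc a)) (cong suc h))
  Offset-suc {D} {a} c<N (inj₁ h) (inj₂ (e , refl)) =
    contradiction (≤-<-trans (≤-trans (m≤n+m N D) (≤-reflexive (trans (cong (D +_) (sym e)) h))) c<N) (<-irrefl refl)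
  Offset-suc {D} {a} {c = c} c<N (inj₂ h) (inj₂ (e , refl)) =
    inj₁ (trans (+-comm D 1) (cong suc (+-cancelʳ-≡ N D c (trans (cong (D +_) (sym e)) h))))

  private
    quotient-≤ : ∀ {D c D' c'} → c' < N → D * N + c ≡ D' * N + c' → D ≤ D'
    quotient-≤ {D} {c} {D'} {c'} c'<N h = ≮⇒≥ λ D'<D → <-irrefl (sym h) (begin-strict
      D' * N + c' <⟨ +-monoʳ-< (D' * N) c'<N ⟩
      D' * N + N  ≡⟨ +-comm (D' * N) N ⟩
      suc D' * N  ≤⟨ *-monoˡ-≤ N D'<D ⟩
      D * N       ≤⟨ m≤m+n _ c ⟩
      D * N + c   ∎)
      where open ≤-Reasoning

  divMod-unique : ∀ {D c D' c'} → c < N → c' < N → D * N + c ≡ D' * N + c' → D ≡ D' × c ≡ c'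
  divMod-unique {D} {c} {D'} {c'} c<N c'<N h with ≤-antisym (quotient-≤ {D} {c} {D'} c'<N h) (quotient-≤ {D'} {c'} {D} c<N (sym h))
  ... | refl = refl , +-cancelˡ-≡ (D * N) c c' h

  divMod-< : ∀ {D c M} → D < M → c < N → D * N + c < M * N
  divMod-< {D} {c} {M} D<M c<N = begin-strict
    D * N + c  <⟨ +-monoʳ-< (D * N) c<N ⟩
    D * N + N  ≡⟨ +-comm (D * N) N ⟩
    suc D * N  ≤⟨ *-monoˡ-≤ N D<M ⟩
    M * N      ∎
    where open ≤-Reasoning

  NextPair : ℕ → ℕ → ℕ → ℕ → Set
  NextPair a c a' c' =
    (suc c ≡ c' × (suc a ≡ a' ⊎ (suc a ≡ N × a' ≡ 0))) ⊎ ((suc c ≡ N × c' ≡ 0) × (a ≡ a' × ¬ suc a ≡ N))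

  private
    carry-index : ∀ D {c} → suc c ≡ N → suc (D * N + c) ≡ suc D * N + 0
    carry-index D {c} e = trans (sym (+-suc (D * N) c)) (trans (cong (D * N +_) e) (trans (+-comm (D * N) N) (sym (+-identityʳ _))))

    -- For c = N - 1 the wrapped case reads (D + 1) + (a + 1) = 2N, which forces D = a = N - 1: the
    -- last pair of all.
    too-big : ∀ {D a c} → suc D < N ⊎ suc a < N → suc D ≤ N → suc a ≤ N → suc c ≡ N → D + suc a ≡ c + N → ⊥
    too-big {D} {a} {c} s D≤ a≤ e h = <-irrefl sum (strict s)
      where
      sum : suc D + suc a ≡ N + N
      sum = trans (cong suc h) (cong (_+ N) e)
      strict : suc D < N ⊎ suc a < N → suc D + suc a < N + N
      strict (inj₁ D<) = +-mono-<-≤ D< a≤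
      strict (inj₂ a<) = +-mono-≤-< D≤ a<

  -- Incrementing a two-digit number in base `N`. Without a carry D is kept, and a follows c
  -- cyclically. With a carry D grows by one and c becomes 0; then D + a + 1 = N - 1 becomes (D + 1)
  -- + a' + 1 = N, so a' = a.
  next-index : ∀ {D a c D' a' c'} → D < N → a < N → c < N → D' < N → a' < N → c' < N →
    Offset N D a c → Offset N D' a' c' → (suc (D * N + c) ≡ D' * N + c') ⇔ NextPair a c a' c'
  next-index {D} {a} {c} {D'} {a'} {c'} D<N a<N c<N D'<N a'<N c'<N o o' = mk⇔ to from
    where
    to : suc (D * N + c) ≡ D' * N + c' → NextPair a c a' c'
    to h with m≤n⇒m<n∨m≡n c<N
    ... | inj₁ c+1<N with divMod-unique {D} {suc c} {D'} c+1<N c'<N (trans (+-suc (D * N) c) h)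
    ...   | refl , refl = inj₁ (refl , cyclic)
      where
      cyclic : CyclicSuc N a a'
      cyclic with m≤n⇒m<n∨m≡n a<N
      ... | inj₁ a+1<N = inj₁ (Offset-unique a+1<N a'<N (Offset-sym {D} (Offset-suc c<N o (inj₁ refl))) (Offset-sym {D} o'))
      ... | inj₂ a+1≡N = inj₂ (a+1≡N , sym (Offset-unique (≤-<-trans z≤n a<N) a'<N (Offset-sym {D} (Offset-suc c<N o (inj₂ (a+1≡N , refl)))) (Offset-sym {D} o')))
    to h | inj₂ c+1≡N with divMod-unique {D'} {c'} {suc D} c'<N (≤-<-trans z≤n c<N) (trans (sym h) (carry-index D c+1≡N))
    ... | refl , refl = inj₂ ((c+1≡N , refl) , turn o o')
      where
      turn : Offset N D a c → Offset N (suc D) a' 0 → a ≡ a' × ¬ suc a ≡ N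
      turn (inj₂ q) _ = ⊥-elim (too-big (inj₁ D'<N) D<N a<N c+1≡N q)
      turn (inj₁ q) (inj₁ ())
      turn (inj₁ q) (inj₂ q') =
        suc-injective (+-cancelˡ-≡ (suc D) _ _ (trans sum (sym q'))) ,
        λ e → <-irrefl (trans e (sym sum)) (s≤s (m≤n+m (suc a) D))
        where
        sum : suc D + suc a ≡ N
        sum = trans (cong suc q) c+1≡N

    from : NextPair a c a' c' → suc (D * N + c) ≡ D' * N + c'
    from (inj₁ (refl , cyc)) = trans (sym (+-suc (D * N) c))
      (cong (λ D → D * N + suc c) (Offset-unique D<N D'<N (Offset-suc c<N o cyc) o'))
    from (inj₂ ((c+1≡N , refl) , (refl , a+1≢N))) = turn o o'
      where
      turn : Offset N D a c → Offset N D' a 0 → suc (D * N + c) ≡ D' * N + 0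
      turn (inj₂ q) _ = ⊥-elim (too-big (inj₂ (≤∧≢⇒< a<N a+1≢N)) D<N a<N c+1≡N q)
      turn (inj₁ q) (inj₁ q') = ⊥-elim (m+1+n≢0 D' q')
      turn (inj₁ q) (inj₂ q') = trans (carry-index D c+1≡N)
        (cong (λ D → D * N + 0) (+-cancelʳ-≡ (suc a) (suc D) D' (trans (trans (cong suc q) c+1≡N) (sym q'))))

open Equivalence using (to; from)

-- Counting

∈-delete : ∀ {A : Set} {x y : A} ys zs → x ≢ y → x ∈ ys ++ y ∷ zs → x ∈ ys ++ zs
∈-delete [] zs x≢y (here x≡y)      = contradiction x≡y x≢y
∈-delete [] zs x≢y (there p)       = p
∈-delete (_ ∷ ys) zs x≢y (here e)  = here e
∈-delete (_ ∷ ys) zs x≢y (there p) = there (∈-delete ys zs x≢y p)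

length-⊆ : ∀ {A : Set} {xs ys : List A} → Unique xs → (∀ {x} → x ∈ xs → x ∈ ys) → length xs ≤ length ys
length-⊆ [] _ = z≤n
length-⊆ {xs = x ∷ xs} (x∉xs ∷ u) sub with ∈-∃++ (sub (here refl))
... | ys , zs , refl = begin
  suc (length xs)             ≤⟨ s≤s (length-⊆ u λ {y} y∈xs → ∈-delete ys zs (λ y≡x → All.lookup x∉xs y∈xs (sym y≡x)) (sub (there y∈xs))) ⟩
  suc (length (ys ++ zs))     ≡⟨ cong suc (length-++ ys) ⟩
  suc (length ys + length zs) ≡⟨ +-suc (length ys) (length zs) ⟨
  length ys + suc (length zs) ≡⟨ length-++ ys ⟨
  length (ys ++ x ∷ zs)       ∎
  where open ≤-Reasoning

map-unique : ∀ {A B : Set} (g : A → B) {xs} → (∀ {x y} → x ∈ xs → y ∈ xs → g x ≡ g y → x ≡ y) →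
             Unique xs → Unique (map g xs)
map-unique g inj [] = []
map-unique g {x ∷ xs} inj (x∉xs ∷ u) =
  All.map⁺ (All.tabulate λ {y} y∈xs gx≡gy → All.lookup x∉xs y∈xs (inj (here refl) (there y∈xs) gx≡gy)) ∷
  map-unique g (λ p q → inj (there p) (there q)) u

∈-allStrings : ∀ w → w ∈ allStrings (length w)
∈-allStrings []          = here refl
∈-allStrings (false ∷ w) = ∈-++⁺ˡ (∈-map⁺ (false ∷_) (∈-allStrings w))
∈-allStrings (true ∷ w)  = ∈-++⁺ʳ (map (false ∷_) (allStrings (length w))) (∈-map⁺ (true ∷_) (∈-allStrings w))

allStrings-length : ∀ n {w} → w ∈ allStrings n → length w ≡ n
allStrings-length zero (here refl) = refl
allStrings-length (suc n) w∈ with ∈-++⁻ (map (false ∷_) (allStrings n)) w∈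
... | inj₁ p with v , v∈ , refl ← ∈-map⁻ (false ∷_) p = cong suc (allStrings-length n v∈)
... | inj₂ p with v , v∈ , refl ← ∈-map⁻ (true ∷_) p = cong suc (allStrings-length n v∈)

allStrings-unique : ∀ n → Unique (allStrings n)
allStrings-unique zero    = [] ∷ []
allStrings-unique (suc n) = Unique.++⁺ (Unique.map⁺ ∷-injectiveʳ (allStrings-unique n))
  (Unique.map⁺ ∷-injectiveʳ (allStrings-unique n)) disjoint
  where
  disjoint : ∀ {w} → w ∈ map (false ∷_) (allStrings n) × w ∈ map (true ∷_) (allStrings n) → ⊥
  disjoint (p , q) with ∈-map⁻ (false ∷_) p | ∈-map⁻ (true ∷_) q
  ... | _ , _ , refl | _ , _ , ()

accepted : (Str → Bool) → ℕ → List Str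
accepted g n = filter (λ w → g w Bool.≟ true) (allStrings n)

module _ {g : Str → Bool} {n : ℕ} where

  accepted-unique : Unique (accepted g n)
  accepted-unique = Unique.filter⁺ (λ w → g w Bool.≟ true) (allStrings-unique n)

  ∈-accepted : ∀ {w} → length w ≡ n → g w ≡ true → w ∈ accepted g n
  ∈-accepted {w} refl gw = ∈-filter⁺ (λ w → g w Bool.≟ true) (∈-allStrings w) gw

  accepted-∈ : ∀ {w} → w ∈ accepted g n → length w ≡ n × g w ≡ true
  accepted-∈ w∈ with p , q ← ∈-filter⁻ (λ w → g w Bool.≟ true) {xs = allStrings n} w∈ = allStrings-length n p , q

nonempty : ∀ {A : Set} {xs : List A} → length xs ≢ 0 → ∃[ x ] x ∈ xs
nonempty {xs = []} h    = contradiction refl h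
nonempty {xs = x ∷ _} h = x , here refl

evens-interleave : ∀ y z → length y ≡ length z → evens (interleave y z) ≡ y
evens-interleave [] [] _            = refl
evens-interleave (a ∷ y) (b ∷ z) eq = cong (a ∷_) (evens-interleave y z (suc-injective eq))

odds-interleave : ∀ y z → length y ≡ length z → odds (interleave y z) ≡ z
odds-interleave [] [] _            = refl
odds-interleave (a ∷ y) (b ∷ z) eq = cong (b ∷_) (odds-interleave y z (suc-injective eq))

interleave-evens-odds : ∀ n w → length w ≡ n + n → interleave (evens w) (odds w) ≡ w
interleave-evens-odds zero [] eq = refl
interleave-evens-odds (suc n) (_ ∷ []) eq = contradiction (trans (suc-injective eq) (+-suc n n)) λ ()
interleave-evens-odds (suc n) (a ∷ b ∷ w) eq =
  cong (λ v → a ∷ b ∷ v) (interleave-evens-odds n w (suc-injective (trans (suc-injective eq) (+-suc n n))))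

-- The order on interleaved pairs

module PairOrder {n m : ℕ} (m≡n+n : m ≡ n + n) {h : Str → Str} (bij : IsBijOn n h) where

  N : ℕ
  N = 2 ^ n

  instance
    N-nonZero : NonZero N
    N-nonZero = m^n≢0 2 n

  2^m≡N*N : 2 ^ m ≡ N * N
  2^m≡N*N = trans (cong (2 ^_) m≡n+n) (^-distribˡ-+-* 2 n n)

  rank : Str → ℕ
  rank y = val (h y)

  rank<N : ∀ {y} → length y ≡ n → rank y < N
  rank<N {y} eq = subst (λ k → val (h y) < 2 ^ k) (proj₁ bij y eq) (val<2^ (h y))

  rank-injective : ∀ {y z} → length y ≡ n → length z ≡ n → rank y ≡ rank z → y ≡ z
  rank-injective {y} {z} y-length z-length eq = proj₁ (proj₂ bij) y z y-length z-length
    (val-injective (trans (proj₁ bij y y-length) (sym (proj₁ bij z z-length))) eq)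

  rank-surjective : ∀ {k} → k < N → ∃[ y ] length y ≡ n × rank y ≡ k
  rank-surjective {k} k<N with y , y-length , eq ← proj₂ (proj₂ bij) (toBits n k) (length-toBits n k) =
    y , y-length , trans (cong val eq) (val-toBits n k<N)

  ≤lex⇔rank≤ : ∀ {y z} → length y ≡ n → length z ≡ n → (h y ≤lex h z) ⇔ (rank y ≤ rank z)
  ≤lex⇔rank≤ {y} {z} y-length z-length = mk⇔ (≤lex⇒val≤ eq) (val≤⇒≤lex eq)
    where
    eq : length (h y) ≡ length (h z)
    eq = trans (proj₁ bij y y-length) (sym (proj₁ bij z z-length))

  evens-length : ∀ {w} → length w ≡ m → length (evens w) ≡ n
  evens-length {w} eq = length-evens-double n w (trans eq m≡n+n)

  odds-length : ∀ {w} → length w ≡ m → length (odds w) ≡ n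
  odds-length {w} eq = trans (length-odds w) (evens-length {w} eq)

  interleave-length : ∀ {y z} → length y ≡ n → length z ≡ n → length (interleave y z) ≡ m
  interleave-length {y} {z} y-length z-length = trans (length-interleave y z (trans y-length (sym z-length)))
    (trans (cong₂ _+_ y-length y-length) (sym m≡n+n))

  block : Str → ℕ
  block w = offset N (rank (evens w)) (rank (odds w))

  index : Str → ℕ
  index w = block w * N + rank (odds w)

  h′ : Str → Str
  h′ w = toBits m (index w)

  module _ {w : Str} (w-length : length w ≡ m) where

    evens<N : rank (evens w) < N
    evens<N = rank<N (evens-length {w} w-length)

    odds<N : rank (odds w) < N
    odds<N = rank<N (odds-length {w} w-length)

    block<N : block w < N
    block<N = proj₁ (offset-Offset evens<N odds<N)

    block-Offset : Offset N (block w) (rank (evens w)) (rank (odds w))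
    block-Offset = proj₂ (offset-Offset evens<N odds<N)

    block-unique : ∀ {D} → D < N → Offset N D (rank (evens w)) (rank (odds w)) → D ≡ block w
    block-unique D<N o = Offset-unique D<N block<N o block-Offset

    val-h′ : val (h′ w) ≡ index w
    val-h′ = val-toBits m (subst (index w <_) (sym 2^m≡N*N) (divMod-< block<N odds<N))

  length-h′ : ∀ w → length (h′ w) ≡ m
  length-h′ w = length-toBits m (index w)

  index-interleave : ∀ {y z D} → length y ≡ n → length z ≡ n → D < N → Offset N D (rank y) (rank z) →
                     index (interleave y z) ≡ D * N + rank z
  index-interleave {y} {z} {D} y-length z-length D<N o
    with w-length ← interleave-length {y} {z} y-length z-length
    -- Bound before the `rewrite`, so that `evens` and `odds` of the interleaving are simplified in
    -- its type as well.
    with unique ← (λ {D} → block-unique {interleave y z} w-length {D})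
    rewrite evens-interleave y z (trans y-length (sym z-length)) | odds-interleave y z (trans y-length (sym z-length)) =
    cong (λ D → D * N + rank z) (sym (unique D<N o))

  -- The block is `k / N` and the second rank `k % N`; by the symmetry of `Offset` the first rank is
  -- then the offset of these two numbers.
  index-surjective : ∀ {k} → k < N * N → ∃[ w ] length w ≡ m × index w ≡ k
  index-surjective {k} k<
    with D<N ← m<n*o⇒m/o<n {k} {N} {N} k<
    with a<N , o ← offset-Offset {N} {k / N} {k % N} D<N (m%n<n k N)
    with y , y-length , y-rank ← rank-surjective a<N
    with z , z-length , z-rank ← rank-surjective (m%n<n k N) =
    interleave y z , interleave-length {y} {z} y-length z-length ,
    trans (index-interleave {y} {z} y-length z-length D<N
            (subst₂ (Offset N (k / N)) (sym y-rank) (sym z-rank) (Offset-sym {N} {offset N (k / N) (k % N)} o)))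
          (trans (cong (k / N * N +_) z-rank) (trans (+-comm (k / N * N) (k % N)) (sym (m≡m%n+[m/n]*n k N))))

  index-injective : ∀ {v w} → length v ≡ m → length w ≡ m → index v ≡ index w → v ≡ w
  index-injective {v} {w} v-length w-length eq
    = trans (sym (interleave-evens-odds n v (trans v-length m≡n+n)))
        (trans (cong₂ interleave
                 (rank-injective (evens-length {v} v-length) (evens-length {w} w-length) a≡)
                 (rank-injective (odds-length {v} v-length) (odds-length {w} w-length) (proj₂ parts)))
               (interleave-evens-odds n w (trans w-length m≡n+n)))
    where
    parts : block v ≡ block w × rank (odds v) ≡ rank (odds w)
    parts = divMod-unique (odds<N {v} v-length) (odds<N {w} w-length) eq
    a≡ : rank (evens v) ≡ rank (evens w)
    a≡ = Offset-unique (evens<N {v} v-length) (evens<N {w} w-length)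
      (Offset-sym {N} {block v} (block-Offset {v} v-length))
      (subst₂ (Offset N (rank (evens w))) (sym (proj₁ parts)) (sym (proj₂ parts))
        (Offset-sym {N} {block w} (block-Offset {w} w-length)))

  h′-bijection : IsBijOn m h′
  h′-bijection = (λ w _ → length-h′ w) ,
    (λ v w v-length w-length eq → index-injective v-length w-length
      (trans (sym (val-h′ {v} v-length)) (trans (cong val eq) (val-h′ {w} w-length)))) ,
    surjective
    where
    surjective : ∀ u → length u ≡ m → ∃[ w ] (length w ≡ m × h′ w ≡ u)
    surjective u u-length
      with w , w-length , eq ← index-surjective {val u} (subst (val u <_) (trans (cong (2 ^_) u-length) 2^m≡N*N) (val<2^ u)) =
      w , w-length , val-injective (trans (length-h′ w) (sym u-length)) (trans (val-h′ {w} w-length) eq)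

  h′≺⇔NextPair : ∀ {v w} → length v ≡ m → length w ≡ m →
    (h′ v ≺lex h′ w) ⇔ NextPair {N} (rank (evens v)) (rank (odds v)) (rank (evens w)) (rank (odds w))
  h′≺⇔NextPair {v} {w} v-length w-length = mk⇔
    (λ v≺w → to nextPair (trans (cong suc (sym (val-h′ {v} v-length))) (trans (to lex v≺w) (val-h′ {w} w-length))))
    (λ nx → from lex (trans (cong suc (val-h′ {v} v-length)) (trans (from nextPair nx) (sym (val-h′ {w} w-length)))))
    where
    lex = ≺lex⇔suc (trans (length-h′ v) (sym (length-h′ w)))
    nextPair = next-index (block<N {v} v-length) (evens<N {v} v-length) (odds<N {v} v-length)
                          (block<N {w} w-length) (evens<N {w} w-length) (odds<N {w} w-length)
                          (block-Offset {v} v-length) (block-Offset {w} w-length)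

  -- Accepting pairs: their number and their interval

  Chained : (Str → Bool) → Str → Set
  Chained acc w = acc (evens w) ≡ true × acc (odds w) ≡ true × suc (rank (evens w)) ≡ rank (odds w)

  module _ {acc acc′ : Str → Bool} (chained : ∀ w → length w ≡ m → (acc′ w ≡ true) ⇔ Chained acc w) where

    private
      A A′ : List Str
      A  = accepted acc n
      A′ = accepted acc′ m

    ∈-A′ : ∀ {w} → w ∈ A′ → length w ≡ m × Chained acc w
    ∈-A′ {w} w∈ with w-length , ok ← accepted-∈ {acc′} {m} w∈ = w-length , to (chained w w-length) ok

    -- Stated without an interval, because it serves the inputs with `f x` equal to 0, for which
    -- none is given.
    none-accepted : length A ≡ 0 → length A′ ≡ 0
    none-accepted empty with A′ in eq
    ... | [] = refl
    ... | w ∷ _ with w-length , ok , _ ← ∈-A′ {w} (subst (w ∈_) (sym eq) (here refl)) =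
      contradiction (subst (1 ≤_) empty (length-⊆ ([] ∷ []) λ { (here refl) → ∈-accepted {acc} (evens-length {w} w-length) ok })) λ ()

    module _ {l u : Str} (l-length : length l ≡ n) (u-length : length u ≡ n)
             (interval : ∀ y → length y ≡ n → (acc y ≡ true) ⇔ (rank l ≤ rank y × rank y ≤ rank u)) where

      private
        odds-injective : ∀ {v w} → v ∈ A′ → w ∈ A′ → odds v ≡ odds w → v ≡ w
        odds-injective {v} {w} v∈ w∈ eq
          with v-length , _ , _ , v-suc ← ∈-A′ v∈ | w-length , _ , _ , w-suc ← ∈-A′ w∈ =
          trans (sym (interleave-evens-odds n v (trans v-length m≡n+n)))
            (trans (cong₂ interleave
                     (rank-injective (evens-length {v} v-length) (evens-length {w} w-length)
                       (suc-injective (trans v-suc (trans (cong rank eq) (sym w-suc))))) eq)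
                   (interleave-evens-odds n w (trans w-length m≡n+n)))

        A⊆ : ∀ {y} → y ∈ A → y ∈ l ∷ map odds A′
        A⊆ {y} y∈ with y-length , y-acc ← accepted-∈ {acc} {n} y∈
                  with l≤y , y≤u ← to (interval y y-length) y-acc
                  with m≤n⇒m<n∨m≡n l≤y
        ... | inj₂ l≡y = here (rank-injective y-length l-length (sym l≡y))
        ... | inj₁ l<y with rank y in y-rank
        ...   | suc k
          with v , v-length , v-rank ← rank-surjective {k} (≤-trans (n≤1+n _) (subst (_< N) y-rank (rank<N y-length))) =
          there (subst (_∈ map odds A′) odds≡ (∈-map⁺ odds (∈-accepted {acc′} w-length (from (chained w w-length) ok))))
          where
          w : Str
          w = interleave v y
          w-length : length w ≡ m
          w-length = interleave-length {v} {y} v-length y-length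
          evens≡ : evens w ≡ v
          evens≡ = evens-interleave v y (trans v-length (sym y-length))
          odds≡ : odds w ≡ y
          odds≡ = odds-interleave v y (trans v-length (sym y-length))
          ok : Chained acc w
          ok rewrite evens≡ | odds≡ =
            from (interval v v-length) (subst (rank l ≤_) (sym v-rank) (≤-pred l<y) , subst (_≤ rank u) (sym v-rank) (≤-trans (n≤1+n k) y≤u)) ,
            y-acc , trans (cong suc v-rank) (sym y-rank)

        l∈A : length A ≢ 0 → l ∈ A
        l∈A some with y , y∈ ← nonempty some
                 with y-length , y-acc ← accepted-∈ {acc} {n} y∈
                 with l≤y , y≤u ← to (interval y y-length) y-acc =
          ∈-accepted {acc} l-length (from (interval l l-length) (≤-refl , ≤-trans l≤y y≤u))

        ⊆A : length A ≢ 0 → ∀ {y} → y ∈ l ∷ map odds A′ → y ∈ A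
        ⊆A some (here refl) = l∈A some
        ⊆A some (there y∈) with w , w∈ , refl ← ∈-map⁻ odds y∈ with w-length , _ , ok , _ ← ∈-A′ w∈ =
          ∈-accepted {acc} (odds-length {w} w-length) ok

        l∉ : ∀ {y} → y ∈ map odds A′ → l ≢ y
        l∉ y∈ refl with w , w∈ , eq ← ∈-map⁻ odds y∈ with w-length , ok , _ , w-suc ← ∈-A′ w∈ =
          <-irrefl (cong rank eq) (≤-trans (s≤s (proj₁ (to (interval (evens w) (evens-length {w} w-length)) ok))) (≤-reflexive w-suc))

        unique : Unique (l ∷ map odds A′)
        unique = All.tabulate l∉ ∷ map-unique odds odds-injective (accepted-unique {acc′} {m})

      -- The map `odds` is a bijection from the accepted pairs to the accepted paths other than `l`.
      -- Such a path has an accepted predecessor, namely the one path of the preceding rank; the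
      -- predecessor of `l` would fall below the interval.
      count-chained : length A ≢ 0 → length A ≡ suc (length A′)
      count-chained some = trans (≤-antisym (length-⊆ (accepted-unique {acc} {n}) A⊆) (length-⊆ unique (⊆A some)))
                                 (cong suc (length-map odds A′))

      -- In block 0 the index is the rank of the second component, so the end points have indices
      -- `suc (rank l)` and `rank u`. Conversely, an index of at most `rank u` is below `N`, which
      -- forces block 0, and a positive index excludes the wrapped pair at its start.
      chained-interval : length A′ ≢ 0 → ∃[ l′ ] ∃[ u′ ] (length l′ ≡ m × length u′ ≡ m ×
        (∀ w → length w ≡ m → (acc′ w ≡ true) ⇔ (h′ l′ ≤lex h′ w × h′ w ≤lex h′ u′)))
      chained-interval some
        -- An accepted pair is needed to know that `suc (rank l)` is below `N` and hence an index.
        with w₀ , w₀∈ ← nonempty some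
        with w₀-length , evens-ok , odds-ok , w₀-suc ← ∈-A′ w₀∈
        with l≤ , _ ← to (interval (evens w₀) (evens-length {w₀} w₀-length)) evens-ok
        with _ , ≤u ← to (interval (odds w₀) (odds-length {w₀} w₀-length)) odds-ok
        with l′ , l′-length , l′-index ← index-surjective {suc (rank l)}
               (<-≤-trans (≤-<-trans (≤-trans (s≤s l≤) (≤-reflexive w₀-suc)) (odds<N {w₀} w₀-length)) (m≤m*n N N))
        with u′ , u′-length , u′-index ← index-surjective {rank u} (<-≤-trans (rank<N u-length) (m≤m*n N N)) =
        l′ , u′ , l′-length , u′-length , λ w w-length → mk⇔ (forward w w-length) (backward w w-length)
        where
        lower : ∀ w → length w ≡ m → (h′ l′ ≤lex h′ w) ⇔ (suc (rank l) ≤ index w)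
        lower w w-length = mk⇔
          (λ p → subst₂ _≤_ (trans (val-h′ {l′} l′-length) l′-index) (val-h′ {w} w-length) (≤lex⇒val≤ (trans (length-h′ l′) (sym (length-h′ w))) p))
          (λ p → val≤⇒≤lex (trans (length-h′ l′) (sym (length-h′ w))) (subst₂ _≤_ (sym (trans (val-h′ {l′} l′-length) l′-index)) (sym (val-h′ {w} w-length)) p))

        upper : ∀ w → length w ≡ m → (h′ w ≤lex h′ u′) ⇔ (index w ≤ rank u)
        upper w w-length = mk⇔
          (λ p → subst₂ _≤_ (val-h′ {w} w-length) (trans (val-h′ {u′} u′-length) u′-index) (≤lex⇒val≤ (trans (length-h′ w) (sym (length-h′ u′))) p))
          (λ p → val≤⇒≤lex (trans (length-h′ w) (sym (length-h′ u′))) (subst₂ _≤_ (sym (val-h′ {w} w-length)) (sym (trans (val-h′ {u′} u′-length) u′-index)) p))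

        forward : ∀ w → length w ≡ m → acc′ w ≡ true → h′ l′ ≤lex h′ w × h′ w ≤lex h′ u′
        forward w w-length ok with e-ok , o-ok , w-suc ← to (chained w w-length) ok =
          from (lower w w-length) (subst (suc (rank l) ≤_) (sym index≡)
            (≤-trans (s≤s (proj₁ (to (interval (evens w) (evens-length {w} w-length)) e-ok))) (≤-reflexive w-suc))) ,
          from (upper w w-length) (subst (_≤ rank u) (sym index≡) (proj₂ (to (interval (odds w) (odds-length {w} w-length)) o-ok)))
          where
          index≡ : index w ≡ rank (odds w)
          index≡ = cong (λ D → D * N + rank (odds w)) (sym (block-unique {w} w-length (m^n>0 2 n) (inj₁ w-suc)))

        backward : ∀ w → length w ≡ m → h′ l′ ≤lex h′ w × h′ w ≤lex h′ u′ → acc′ w ≡ true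
        backward w w-length (p , q) = first-block (block w) refl
          where
          first-block : ∀ D → block w ≡ D → acc′ w ≡ true
          first-block (suc D) eq = contradiction (≤-<-trans (≤-trans (m≤m+n N (D * N)) (≤-trans (m≤m+n _ (rank (odds w)))
            (subst (λ D → D * N + rank (odds w) ≤ rank u) eq (to (upper w w-length) q)))) (rank<N u-length)) (<-irrefl refl)
          first-block zero eq with subst (λ D → Offset N D (rank (evens w)) (rank (odds w))) eq (block-Offset {w} w-length)
                              | subst (λ D → suc (rank l) ≤ D * N + rank (odds w)) eq (to (lower w w-length) p)
                              | subst (λ D → D * N + rank (odds w) ≤ rank u) eq (to (upper w w-length) q)
          ... | inj₂ wrap | l<c | _ = contradiction (≤-trans (+-monoˡ-≤ N (≤-trans (s≤s z≤n) l<c)) (≤-reflexive (sym wrap)))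
                                        (<⇒≱ (s≤s (evens<N {w} w-length)))
          ... | inj₁ step | l<c | c≤u = from (chained w w-length)
            (from (interval (evens w) (evens-length {w} w-length))
               (≤-pred (subst (suc (rank l) ≤_) (sym step) l<c) , ≤-trans (n≤1+n _) (≤-trans (≤-reflexive step) c≤u)) ,
             from (interval (odds w) (odds-length {w} w-length)) (≤-trans (n≤1+n _) l<c , c≤u) , step)

-- Boolean formulas and the propositions they decide

module _ {P Q : Set} where

  ∧-reflects : ∀ {a b} → (a ≡ true ⇔ P) → (b ≡ true ⇔ Q) → (a ∧ b ≡ true ⇔ (P × Q))
  ∧-reflects {true} p q  = mk⇔ (λ b → to p refl , to q b) (λ (_ , y) → from q y)
  ∧-reflects {false} p q = mk⇔ (λ ()) (λ (x , _) → from p x)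

  ∨-reflects : ∀ {a b} → (a ≡ true ⇔ P) → (b ≡ true ⇔ Q) → (a ∨ b ≡ true ⇔ (P ⊎ Q))
  ∨-reflects {true} p q  = mk⇔ (λ _ → inj₁ (to p refl)) (λ _ → refl)
  ∨-reflects {false} p q = mk⇔ (λ b → inj₂ (to q b)) [ (λ x → contradiction (from p x) λ ()) , from q ]′

not-reflects : ∀ {P : Set} {a} → (a ≡ true ⇔ P) → (not a ≡ true ⇔ (¬ P))
not-reflects {a = true} p  = mk⇔ (λ ()) (λ ¬x → contradiction (to p refl) ¬x)
not-reflects {a = false} p = mk⇔ (λ _ x → contradiction (from p x) λ ()) (λ _ → refl)

sameStr-reflects : ∀ s t → (sameStr s t ≡ true) ⇔ (s ≡ t)
sameStr-reflects s t = mk⇔ (λ e → sym (same?-enc⇒≡ t s e)) λ { refl → same?-refl s }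

-- The decrement at a fixed input

module Decrement (f : Str → ℕ) (p : Poly) (M : BalancedNPTM p) (b t : Str → Str) (prec : PolyPred3) (x : Str)
  (h : Str → Str) (bij : IsBijOn (eval p (length x)) h)
  (b-length : length (b x) ≡ eval p (length x)) (t-length : length (t x) ≡ eval p (length x))
  (hb : h (b x) ≡ replicate (eval p (length x)) false) (ht : h (t x) ≡ replicate (eval p (length x)) true)
  (prec-spec : ∀ y z → length y ≡ eval p (length x) → length z ≡ eval p (length x) → holds3 prec x y z ⇔ (h y ≺lex h z))
  where

  n m : ℕ
  n = eval p (length x)
  m = eval (p ⊕ p) (length x)

  open PairOrder (eval-⊕ p p (length x)) bij public

  rank-b : rank (b x) ≡ 0
  rank-b = trans (cong val hb) (val-zeros n)

  rank-t : suc (rank (t x)) ≡ N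
  rank-t = trans (cong suc (cong val ht)) (val-ones n)

  -- The ranks are N - 1 and 0, and (N - 1) + 1 = 0 + N puts the pair into block 0 by the wrapped
  -- case, at index 0.
  bottom-zeros : h′ (interleave (t x) (b x)) ≡ replicate m false
  bottom-zeros = val-injective (trans (length-h′ w) (sym (length-replicate m)))
    (trans (val-h′ {w} (interleave-length {t x} {b x} t-length b-length))
      (trans (index-interleave {t x} {b x} {0} t-length b-length (m^n>0 2 n)
               (inj₂ (trans rank-t (cong (_+ N) (sym rank-b)))))
        (trans rank-b (sym (val-zeros m)))))
    where
    w : Str
    w = interleave (t x) (b x)

  -- Equal components have offset N - 1, so this pair lies in the last block, and its second rank N
  -- - 1 puts it at the end.
  top-ones : h′ (interleave (t x) (t x)) ≡ replicate m true
  top-ones = val-injective (trans (length-h′ w) (sym (length-replicate m))) (suc-injective (begin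
    suc (val (h′ w))            ≡⟨ cong suc (val-h′ {w} (interleave-length {t x} {t x} t-length t-length)) ⟩
    suc (index w)               ≡⟨ cong suc (index-interleave {t x} {t x} {r} t-length t-length
                                     (≤-reflexive rank-t) (inj₂ (cong (r +_) rank-t))) ⟩
    suc (r * N + r)             ≡⟨ +-suc (r * N) r ⟨
    r * N + suc r               ≡⟨ cong (r * N +_) rank-t ⟩
    r * N + N                   ≡⟨ +-comm (r * N) N ⟩
    suc r * N                   ≡⟨ cong (_* N) rank-t ⟩
    N * N                       ≡⟨ 2^m≡N*N ⟨
    2 ^ m                       ≡⟨ val-ones m ⟨
    suc (val (replicate m true)) ∎))
    where
    open ≡-Reasoning
    w : Str
    w = interleave (t x) (t x)
    r : ℕ
    r = rank (t x)

  module _ {y z : Str} (y-length : length y ≡ n) (z-length : length z ≡ n) where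

    ≺-reflects : (holds3? prec x y z ≡ true) ⇔ (suc (rank y) ≡ rank z)
    ≺-reflects = mk⇔ (λ e → to lex (to (prec-spec y z y-length z-length) e))
                     (λ e → from (prec-spec y z y-length z-length) (from lex e))
      where
      lex = ≺lex⇔suc (trans (proj₁ bij y y-length) (sym (proj₁ bij z z-length)))

    same-reflects : (sameStr y z ≡ true) ⇔ (rank y ≡ rank z)
    same-reflects = mk⇔ (λ e → cong rank (to (sameStr-reflects y z) e))
                        (λ e → from (sameStr-reflects y z) (rank-injective y-length z-length e))

  module _ {y : Str} (y-length : length y ≡ n) where

    top-reflects : (sameStr y (t x) ≡ true) ⇔ (suc (rank y) ≡ N)
    top-reflects = mk⇔ (λ e → trans (cong suc (to same-rank e)) rank-t)
                       (λ e → from same-rank (suc-injective (trans e (sym rank-t))))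
      where
      same-rank = same-reflects y-length t-length

    bottom-reflects : (sameStr y (b x) ≡ true) ⇔ (rank y ≡ 0)
    bottom-reflects = mk⇔ (λ e → trans (to same-rank e) rank-b) (λ e → from same-rank (trans e (sym rank-b)))
      where
      same-rank = same-reflects y-length b-length

  -- The formula has the shape of `NextPair`, and atoms match one by one: `≺` is the successor of
  -- ranks, equality with `t x` is rank N - 1, equality with `b x` is rank 0.
  pairPrec-reflects : ∀ v w → length v ≡ m → length w ≡ m → (pairPrec? prec b t x v w ≡ true) ⇔ (h′ v ≺lex h′ w)
  pairPrec-reflects v w v-length w-length = mk⇔
    (λ e → from nextPair (to formula e)) (λ e → from formula (to nextPair e))
    where
    nextPair = h′≺⇔NextPair {v} {w} v-length w-length
    ve = evens-length {v} v-length
    vo = odds-length {v} v-length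
    we = evens-length {w} w-length
    wo = odds-length {w} w-length
    formula = ∨-reflects
      (∧-reflects (≺-reflects vo wo)
        (∨-reflects (≺-reflects ve we) (∧-reflects (top-reflects ve) (bottom-reflects we))))
      (∧-reflects (∧-reflects (top-reflects vo) (bottom-reflects wo))
        (∧-reflects (same-reflects ve we) (not-reflects (top-reflects ve))))

  chained : ∀ w → length w ≡ m → (Acc (pairNPTM p M prec) x w) ⇔ Chained (accPath M x) w
  chained w w-length = mk⇔ (λ e → to formula (trans (sym acc-path) e)) (λ e → trans acc-path (from formula e))
    where
    acc-path = accPath-pair p M prec x w w-length
    formula = ∧-reflects {a = accPath M x (evens w)} (mk⇔ (λ e → e) (λ e → e))
      (∧-reflects {a = accPath M x (odds w)} (mk⇔ (λ e → e) (λ e → e)) (≺-reflects (evens-length {w} w-length) (odds-length {w} w-length)))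

  Interval : (Str → Bool) → (Str → Str) → ℕ → Set
  Interval acc k len = ∃[ l ] ∃[ u ] (length l ≡ len × length u ≡ len ×
    (∀ w → length w ≡ len → (acc w ≡ true ⇔ (k l ≤lex k w × k w ≤lex k u))))

  module _ (f-interval : f x ≢ 0 → Interval (accPath M x) h n) (f-count : f x ≡ numAcc M x) where

    private
      ranks : ∀ {l u} → length l ≡ n → length u ≡ n →
        (∀ y → length y ≡ n → (Acc M x y ⇔ (h l ≤lex h y × h y ≤lex h u))) →
        ∀ y → length y ≡ n → (Acc M x y ⇔ (rank l ≤ rank y × rank y ≤ rank u))
      ranks {l} {u} l-length u-length iv y y-length = mk⇔
        (λ e → let (p , q) = to (iv y y-length) e in to (≤lex⇔rank≤ l-length y-length) p , to (≤lex⇔rank≤ y-length u-length) q)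
        (λ (p , q) → from (iv y y-length) (from (≤lex⇔rank≤ l-length y-length) p , from (≤lex⇔rank≤ y-length u-length) q))

    new-count : f x ∸ 1 ≡ numAcc (pairNPTM p M prec) x
    new-count with f x ≟ 0
    ... | yes e = trans (cong (_∸ 1) e) (sym (none-accepted chained (trans (sym f-count) e)))
    ... | no e with l , u , l-length , u-length , iv ← f-interval e =
      trans (cong (_∸ 1) f-count) (cong (_∸ 1)
        (count-chained chained l-length u-length (ranks l-length u-length iv) (λ c → e (trans f-count c))))

    new-interval : f x ∸ 1 ≢ 0 → Interval (accPath (pairNPTM p M prec) x) h′ m
    new-interval e with l , u , l-length , u-length , iv ← f-interval (λ z → e (cong (_∸ 1) z)) =
      chained-interval chained l-length u-length (ranks l-length u-length iv) (λ z → e (trans new-count z))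

theorem4p3 : (f : Str → ℕ) → CLUSharpP f → CLUSharpP (λ x → f x ∸ 1)
theorem4p3 f (p , M , b , t , FPb , FPt′ , prec , spec) =
  p ⊕ p , pairNPTM p M prec , (λ x → interleave (t x) (b x)) , (λ x → interleave (t x) (t x)) ,
  FPt-interleave FPt′ FPb p t-length b-length , FPt-interleave FPt′ FPt′ p t-length t-length ,
  pairPrec prec FPb FPt′ p b-length t-length , λ x →
    let (h , bij , bl , tl , hb , ht , ≺h , interval , count) = spec x
        open Decrement f p M b t prec x h bij bl tl hb ht ≺h
    in h′ , h′-bijection , interleave-length {t x} {b x} tl bl , interleave-length {t x} {t x} tl tl ,
       bottom-zeros , top-ones ,
       (λ v w v-length w-length → mk⇔
         (λ e → to (pairPrec-reflects v w v-length w-length) (trans (sym (holds3-pair prec FPb FPt′ p b-length t-length x v w)) e))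
         (λ e → trans (holds3-pair prec FPb FPt′ p b-length t-length x v w) (from (pairPrec-reflects v w v-length w-length) e))) ,
       new-interval interval count , new-count interval count
  where
  b-length : ∀ x → length (b x) ≡ eval p (length x)
  b-length x = proj₁ (proj₂ (proj₂ (spec x)))
  t-length : ∀ x → length (t x) ≡ eval p (length x)
  t-length x = proj₁ (proj₂ (proj₂ (proj₂ (spec x))))
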